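{- Let $H$ be a finite simple graph with $\Delta(H)\le 2$, and let $G$ be obtained from $H$ by gluing in vertex-disjoint copies of $K_4$, i.e. there are pairwise disjoint $4$-element subsets $Y_1,\dots,Y_q\subseteq V(H)$ and $G$ has vertex set $V(H)$ and edge set $E(H)\cup\{uv: u\neq v,\ u,v\in Y_j \text{ for some } j\}$. Let $\mathcal{C}$ be the set of odd cycles of $H$ of length greater than $3$, and let $V(\mathcal{C})$ be the set of vertices lying on these cycles. Then there is a set $Z\subseteq V(\mathcal{C})$ with $|Z|\le |\mathcal{C}|/2$ such that $G-Z$ is $4$-colorable and $Z$ contains at most one vertex from each cycle of $\mathcal{C}$. Moreover, $|V(G)\setminus Z|\ge \tfrac{9}{10}|V(G)|$.
   Context: All graphs are finite and simple; the cycles of $H$ are its cycle components. -}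

module Defs where

open import Data.Fin using (Fin; zero; suc; toℕ; inject₁)
import Data.Fin.Properties as Fin
open import Data.Fin.Subset
  using (Subset; inside; outside; _∈_; _∉_; _∩_; ∣_∣; Nonempty; Empty)
open import Data.Fin.Subset.Properties using (_∈?_)
open import Data.List using (List; []; _∷_; _++_; map; filter; allFin)
import Data.List.Extrema.Nat as Extrema
import Data.List.Membership.Propositional as List
open import Data.List.Membership.Propositional.Properties
  using (∈-map⁺; ∈-map⁻; ∈-++⁺ˡ; ∈-++⁺ʳ; ∈-filter⁺; ∈-filter⁻)
open import Data.List.Relation.Unary.All using ([])
open import Data.List.Relation.Unary.AllPairs using ([]; _∷_)
open import Data.List.Relation.Unary.Any using (here)
open import Data.List.Relation.Unary.Unique.Propositional using (Unique)
import Data.List.Relation.Unary.Unique.Propositional.Properties as Unique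
open import Data.Nat using (ℕ; zero; suc; _≤_; _<_; _≤?_; _<?_; _≟_; _%_)
open import Data.Product using (∃; _×_; _,_; proj₁; proj₂)
open import Data.Sum using (_⊎_; inj₁; inj₂)
open import Data.Vec using (Vec; []; _∷_; lookup; tabulate)
open import Data.Vec.Properties using (∷-injectiveʳ)
open import Function using (_∘_; _on_)
open import Function.Bundles using (_⇔_; mk⇔; module Equivalence)
open import Relation.Binary using (Decidable; Symmetric; Irreflexive)
open import Relation.Binary.Construct.Closure.ReflexiveTransitive
  using (Star; ε; _◅_; _◅◅_; reverse)
open import Relation.Binary.PropositionalEquality
  using (_≡_; _≢_; refl; sym; cong)
open import Relation.Nullary using (¬_; Dec; does)
open import Relation.Nullary.Decidable
  using (map′; _×-dec_; _⊎-dec_; _→-dec_; ¬?)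
open import Relation.Unary using () renaming (Decidable to Decidable₁)

open Equivalence using (to; from)

private variable
  n k : ℕ
  V : Set

record Graph (V : Set) : Set₁ where
  field
    Adj    : V → V → Set
    adj?   : Decidable Adj
    symm   : Symmetric Adj
    irrefl : Irreflexive _≡_ Adj

open Graph public

neighbours : Graph (Fin n) → Fin n → Subset n
neighbours H v = tabulate (λ u → does (adj? H v u))

Δ : Graph (Fin n) → ℕ
Δ {n} H = Extrema.max 0 (map (λ v → ∣ neighbours H v ∣) (allFin n))

PairwiseDisjoint : ∀ {q} → (Fin q → Subset n) → Set
PairwiseDisjoint Y = ∀ i j → i ≢ j → Empty (Y i ∩ Y j)

glueCliques : ∀ {q} → Graph (Fin n) → (Fin q → Subset n) → Graph (Fin n)
glueCliques H Y = record
  { Adj    = λ u v → Adj H u v ⊎ (u ≢ v × ∃ λ j → u ∈ Y j × v ∈ Y j)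
  ; adj?   = λ u v → adj? H u v
               ⊎-dec (¬? (u Fin.≟ v) ×-dec Fin.any? (λ j → (u ∈? Y j) ×-dec (v ∈? Y j)))
  ; symm   = λ { (inj₁ uv) → inj₁ (symm H uv)
               ; (inj₂ (u≢v , j , u∈ , v∈)) → inj₂ (u≢v ∘ sym , j , v∈ , u∈) }
  ; irrefl = λ { u≡v (inj₁ uv) → irrefl H u≡v uv
               ; u≡v (inj₂ (u≢v , _)) → u≢v u≡v }
  }

infixl 6 _-ᵍ_

_-ᵍ_ : Graph (Fin n) → (Z : Subset n) → Graph (∃ λ v → v ∉ Z)
G -ᵍ Z = record
  { Adj    = Adj G on proj₁
  ; adj?   = λ u v → adj? G (proj₁ u) (proj₁ v)
  ; symm   = symm G
  ; irrefl = irrefl G ∘ cong proj₁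
  }

Colourable : ℕ → Graph V → Set
Colourable {V} k G = ∃ λ (c : V → Fin k) → ∀ {u v} → Adj G u v → c u ≢ c v

IsComponent : Graph (Fin n) → Subset n → Set
IsComponent H S = Nonempty S × (∀ u → u ∈ S → ∀ v → v ∈ S ⇔ Star (Adj H) u v)

Next : Fin k → Fin k → Set
Next {k} i j = toℕ j ≡ suc (toℕ i) ⊎ (suc (toℕ i) ≡ k × toℕ j ≡ 0)

-- The induced subgraph H[S] is a cycle on k ≥ 3 vertices, listed in cyclic order.
-- The number k is taken to be ∣ S ∣, which is forced because the listing
-- is a bijection onto S.
IsCycle : Graph (Fin n) → Subset n → Set
IsCycle {n} H S = 3 ≤ ∣ S ∣ × ∃ λ (vs : Vec (Fin n) ∣ S ∣) →
    (∀ i j → lookup vs i ≡ lookup vs j → i ≡ j)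
  × (∀ v → v ∈ S ⇔ (∃ λ i → lookup vs i ≡ v))
  × (∀ i j → Adj H (lookup vs i) (lookup vs j) ⇔ (Next i j ⊎ Next j i))

-- A cycle component is an induced subgraph, so it is identified with its vertex set.
IsLongOddCycle : Graph (Fin n) → Subset n → Set
IsLongOddCycle H S =
  (IsComponent H S × IsCycle H S) × ∣ S ∣ % 2 ≡ 1 × 3 < ∣ S ∣

-- For a closed vertex set inducing a cycle, connectedness is automatic; this is
-- what makes IsLongOddCycle decidable without deciding reachability.
private
  _⇔?_ : ∀ {A B : Set} → Dec A → Dec B → Dec (A ⇔ B)
  a? ⇔? b? = map′ (λ (f , g) → mk⇔ f g) (λ e → to e , from e)
                  ((a? →-dec b?) ×-dec (b? →-dec a?))

  next? : (i j : Fin k) → Dec (Next i j)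
  next? {k} i j = (toℕ j ≟ suc (toℕ i)) ⊎-dec ((suc (toℕ i) ≟ k) ×-dec (toℕ j ≟ 0))

  anyVec? : {P : Vec (Fin n) k → Set} → Decidable₁ P → Dec (∃ P)
  anyVec? {k = zero}  P? = map′ (λ p → [] , p) (λ { ([] , p) → p }) (P? [])
  anyVec? {k = suc k} P? =
    map′ (λ (x , xs , p) → x ∷ xs , p) (λ { (x ∷ xs , p) → x , xs , p })
         (Fin.any? (λ x → anyVec? (λ xs → P? (x ∷ xs))))

  isCycle? : (H : Graph (Fin n)) → Decidable₁ (IsCycle H)
  isCycle? H S = (3 ≤? ∣ S ∣) ×-dec anyVec? (λ vs →
          Fin.all? (λ i → Fin.all? (λ j →
            (lookup vs i Fin.≟ lookup vs j) →-dec (i Fin.≟ j)))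
    ×-dec Fin.all? (λ v → (v ∈? S) ⇔? Fin.any? (λ i → lookup vs i Fin.≟ v))
    ×-dec Fin.all? (λ i → Fin.all? (λ j →
            adj? H (lookup vs i) (lookup vs j) ⇔? (next? i j ⊎-dec next? j i))))

  Closed : Graph (Fin n) → Subset n → Set
  Closed H S = ∀ u v → u ∈ S → Adj H u v → v ∈ S

  closed? : (H : Graph (Fin n)) → Decidable₁ (Closed H)
  closed? H S = Fin.all? λ u → Fin.all? λ v →
    (u ∈? S) →-dec (adj? H u v →-dec (v ∈? S))

  component⇒closed : (H : Graph (Fin n)) (S : Subset n) → IsComponent H S → Closed H S
  component⇒closed H S (_ , comp) u v u∈S uv = from (comp u u∈S v) (uv ◅ ε)

  closed-Star : (H : Graph (Fin n)) (S : Subset n) → Closed H S →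
                ∀ {u v} → u ∈ S → Star (Adj H) u v → v ∈ S
  closed-Star H S cl u∈S ε          = u∈S
  closed-Star H S cl u∈S (uw ◅ wv) = closed-Star H S cl (cl _ _ u∈S uw) wv

  walk : (H : Graph (Fin n)) (vs : Vec (Fin n) (suc k)) →
         (∀ i j → Next i j → Adj H (lookup vs i) (lookup vs j)) →
         ∀ m (i : Fin (suc k)) → toℕ i ≡ m →
         Star (Adj H) (lookup vs zero) (lookup vs i)
  walk H vs step m       zero    _    = ε
  walk {k = k} H vs step (suc m) (suc i) refl =
    walk H vs step m i⁻ i⁻≡m
      ◅◅ (step i⁻ (suc i) (inj₁ (cong suc (sym i⁻≡m))) ◅ ε)
    where
    i⁻ : Fin (suc k)
    i⁻ = inject₁ i
    i⁻≡m : toℕ i⁻ ≡ toℕ i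
    i⁻≡m = Fin.toℕ-inject₁ i

  connected : (H : Graph (Fin n)) (vs : Vec (Fin n) k) →
              (∀ i j → Next i j → Adj H (lookup vs i) (lookup vs j)) →
              ∀ i j → Star (Adj H) (lookup vs i) (lookup vs j)
  connected {k = suc k} H vs step i j =
    reverse (symm H) (walk H vs step _ i refl) ◅◅ walk H vs step _ j refl

  first : (vs : Vec (Fin n) k) → 3 ≤ k → Fin k
  first (_ ∷ _) _ = zero

  closed⇒component : (H : Graph (Fin n)) (S : Subset n) →
                     IsCycle H S → Closed H S → IsComponent H S
  closed⇒component H S (3≤k , vs , _ , onto , adj) cl =
      (lookup vs v₀ , from (onto _) (v₀ , refl))
    , λ u u∈S v → mk⇔ (conn u u∈S v) (closed-Star H S cl u∈S)
    where
    v₀ = first vs 3≤k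
    conn : ∀ u → u ∈ S → ∀ v → v ∈ S → Star (Adj H) u v
    conn u u∈S v v∈S with to (onto u) u∈S | to (onto v) v∈S
    ... | i , refl | j , refl = connected H vs (λ i j nx → from (adj i j) (inj₁ nx)) i j

isLongOddCycle? : (H : Graph (Fin n)) → Decidable₁ (IsLongOddCycle H)
isLongOddCycle? H S =
  map′ (λ (cl , cy) → closed⇒component H S cy cl , cy)
       (λ (co , cy) → component⇒closed H S co , cy)
       (closed? H S ×-dec isCycle? H S)
  ×-dec (∣ S ∣ % 2 ≟ 1) ×-dec (3 <? ∣ S ∣)

subsets : ∀ n → List (Subset n)
subsets zero    = [] ∷ []
subsets (suc n) = map (outside ∷_) (subsets n) ++ map (inside ∷_) (subsets n)

∈-subsets : (S : Subset n) → S List.∈ subsets n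
∈-subsets []            = here refl
∈-subsets (outside ∷ S) = ∈-++⁺ˡ (∈-map⁺ _ (∈-subsets S))
∈-subsets (inside  ∷ S) = ∈-++⁺ʳ _ (∈-map⁺ _ (∈-subsets S))

subsets-unique : ∀ n → Unique (subsets n)
subsets-unique zero    = [] ∷ []
subsets-unique (suc n) = Unique.++⁺
  (Unique.map⁺ ∷-injectiveʳ (subsets-unique n))
  (Unique.map⁺ ∷-injectiveʳ (subsets-unique n))
  λ (x∈ , x∈′) → clash (∈-map⁻ _ x∈) (∈-map⁻ _ x∈′)
  where
  clash : ∀ {x} → (∃ λ y → y List.∈ subsets n × x ≡ outside ∷ y) →
          ¬ (∃ λ y → y List.∈ subsets n × x ≡ inside ∷ y)
  clash (_ , _ , refl) (_ , _ , ())

-- Each long odd cycle is listed exactly once, so the length of this list is the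
-- number of such cycles; see ∈-longOddCycles and longOddCycles-unique.
longOddCycles : Graph (Fin n) → List (Subset n)
longOddCycles {n} H = filter (isLongOddCycle? H) (subsets n)

∈-longOddCycles : (H : Graph (Fin n)) (S : Subset n) →
                  S List.∈ longOddCycles H ⇔ IsLongOddCycle H S
∈-longOddCycles H S =
  mk⇔ (proj₂ ∘ ∈-filter⁻ (isLongOddCycle? H) {xs = subsets _})
      (∈-filter⁺ (isLongOddCycle? H) (∈-subsets S))

longOddCycles-unique : (H : Graph (Fin n)) → Unique (longOddCycles H)
longOddCycles-unique {n} H = Unique.filter⁺ (isLongOddCycle? H) (subsets-unique n)

{-# OPTIONS --safe #-}

-- Let s be a permutation such that every edge of H joins some v to s v, and let m match
-- vertices along the cycles of s so that each long odd cycle of H has one unmatched vertex and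
-- every other vertex with two neighbours is matched to one of them, or they to each other.
-- Let p split every Yⱼ into two pairs. The union of two matchings is bipartite, so there is a
-- two-colouring ("sides") in which the pairs of m and of p are bichromatic. If the unmatched
-- vertices lying on the same side as both of their neighbours are deleted, every vertex has at
-- most one H-neighbour and at most one partner in its Yⱼ on its own side. These two matchings
-- have a bipartite union again, and the two two-colourings together use four colours.
--
-- Only half of the unmatched vertices have to be deleted. The two sides may be exchanged on
-- each component of m ∪ p separately, so by a max-cut argument it is enough that every
-- unmatched w on a long odd cycle has a neighbour in another component. Put u = s w and
-- x = s u = m u, and consider the component S of w after unmatching u and x: it is a path, so
-- it does not contain both u and x. If it contains neither, u is not in the component of w.
-- Otherwise match w with u, so that x is unmatched: if u ∈ S, then x is not in the component
-- of its neighbour u; if x ∈ S, the vertex sets of the components have not changed, and we go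
-- on with x. Since the cycle is odd, it has a vertex whose component meets the cycle in no
-- other vertex once the whole cycle is unmatched, and the procedure stops there at the latest.

module Submission where

open import Defs
open import Algebra.Bundles using (CommutativeRing)
import Algebra.Properties.CommutativeSemigroup as CommutativeSemigroup
open import Data.Bool using (Bool; true; false; not; _xor_; _∧_)
import Data.Bool.Properties as Bool
open import Data.Bool.Properties using (not-¬; ¬-not; not-involutive)
open import Data.Fin using (Fin; zero; suc; toℕ; fromℕ<; combine; remQuot)
open import Data.Fin.Permutation
  using (Permutation′; _⟨$⟩ʳ_; _⟨$⟩ˡ_; inverseʳ; inverseˡ; _∘ₚ_; transpose) renaming (id to idₚ)
import Data.Fin.Permutation.Components as Components
import Data.Fin.Properties as Fin
open import Data.Fin.Subset
  using (Subset; ∣_∣; _∈_; _∉_; _⊆_; _∩_; ⋃; ∁)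
open import Data.Fin.Subset.Properties using (_∈?_; x∈p∩q⁺; x∈p∩q⁻; x∈p∪q⁺; ∣∁p∣≡n∸∣p∣)
open import Data.List
  using (List; []; _∷_; _++_; length; filterᵇ; allFin; applyUpTo)
import Data.List as List
open import Data.List.Extrema.Nat using (xs≤max)
import Data.List.Membership.Propositional as List
open import Data.List.Membership.Propositional using (find; lose)
open import Data.List.Membership.Propositional.Properties
  using (∈-map⁺; ∈-allFin; ∈-∃++; ∈-applyUpTo⁺; ∈-applyUpTo⁻)
open import Data.List.Properties using (length-applyUpTo; length-tabulate)
open import Data.List.Relation.Binary.Permutation.Propositional
  using (_↭_; ↭⇒↭ₛ; ↭-prep; ↭-sym)
open import Data.List.Relation.Binary.Permutation.Propositional.Properties
  using (shift; ∈-resp-↭; ↭-length)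
import Data.List.Relation.Binary.Permutation.Setoid.Properties as SetoidPermutation
open import Data.List.Relation.Unary.All as All using (All; _∷_)
open import Data.List.Relation.Unary.AllPairs using (_∷_)
open import Data.List.Relation.Unary.Any using (here; there; any?)
open import Data.List.Relation.Unary.Any.Properties using (lookup-index)
open import Data.List.Relation.Unary.Unique.Propositional using (Unique)
open import Data.List.Relation.Unary.Unique.Propositional.Properties using (applyUpTo⁺₁)
open import Data.Nat
  using (ℕ; zero; suc; _+_; _*_; _∸_; _%_; _≤_; _<_; z≤n; s≤s; z<s; s≤s⁻¹; _≤?_; _<?_; _<ᵇ_; parity)
open import Data.Nat.GeneralisedArithmetic using (fold; fold-+)
import Data.Nat.Properties as ℕ
open import Data.Parity.Base using (0ℙ; 1ℙ) renaming (_⁻¹ to flip)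
import Data.Parity.Base as Parity
import Data.Parity.Properties as Parity
open import Data.Product using (∃; ∃₂; _×_; _,_; proj₁; proj₂)
open import Data.Sum as Sum using (_⊎_; inj₁; inj₂; [_,_]; [_,_]′)
open import Data.Unit using (tt)
open import Data.Vec using (Vec; []; _∷_; here; there; head; tail; lookup; tabulate)
import Data.Vec.Properties as Vec
open import Data.Vec.Properties
  using ([]=⇒lookup; lookup⇒[]=; lookup∘tabulate; ∷-injectiveˡ; ∷-injectiveʳ)
open import Function using (_∘_; id)
open import Function.Bundles using (mk⇔; module Equivalence)
open import Function.Definitions using (Injective)
open import Relation.Binary.Construct.Closure.ReflexiveTransitive using (Star; ε; _◅_; _◅◅_)
open import Relation.Binary.Definitions
  using (DecidableEquality; Symmetric; Irreflexive; tri<; tri≈; tri>)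
open import Relation.Binary.PropositionalEquality hiding ([_])
open import Relation.Binary.PropositionalEquality.Properties using (setoid)
open import Relation.Nullary using (¬_; Dec; yes; no; does; contradiction)
open import Relation.Nullary.Decidable
  using (map′; dec-true; dec-false; decidable-stable; from-yes; ¬?; _×-dec_; _⊎-dec_; _→-dec_)
open import Relation.Unary using () renaming (Decidable to Decidable₁)

open Equivalence using (to; from)

-- Orbits of a permutation of a finite set

Involutive : {A : Set} → (A → A) → Set
Involutive f = ∀ x → f (f x) ≡ x

involutive⇒injective : ∀ {A : Set} (f : A → A) → Involutive f → Injective _≡_ _≡_ f
involutive⇒injective f inv {x} {y} fx≡fy =
  trans (sym (inv x)) (trans (cong f fx≡fy) (inv y))

leastWitness : {P : ℕ → Set} → Decidable₁ P → ∀ k → P k →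
               ∃ λ m → m ≤ k × P m × (∀ i → i < m → ¬ P i)
leastWitness P? k pk with P? 0
leastWitness P? k pk       | yes p₀ = 0 , z≤n , p₀ , λ _ ()
leastWitness P? zero pk    | no ¬p₀ = contradiction pk ¬p₀
leastWitness P? (suc k) pk | no ¬p₀ with leastWitness (P? ∘ suc) k pk
... | m , m≤k , pm , below = suc m , s≤s m≤k , pm ,
  λ { zero _ → ¬p₀ ; (suc i) i<m → below i (s≤s⁻¹ i<m) }

-- Finiteness of `A` enters only through the injection `e` into `Fin N`, so that vertices as well as
-- pairs of a vertex and a bit can be treated.
module Orbit {A : Set} {N : ℕ} (e : A → Fin N) (e-inj : Injective _≡_ _≡_ e)
             (π : A → A) (π-inj : Injective _≡_ _≡_ π) where

  infix 4 _≟ᴬ_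
  _≟ᴬ_ : DecidableEquality A
  x ≟ᴬ y = map′ e-inj (cong e) (e x Fin.≟ e y)

  π^ : ℕ → A → A
  π^ i x = fold x π i

  π^-+ : ∀ i j x → π^ (i + j) x ≡ π^ i (π^ j x)
  π^-+ i j x = fold-+ x π i

  π^-suc : ∀ i x → π^ (suc i) x ≡ π^ i (π x)
  π^-suc i x = trans (cong (λ k → π^ k x) (ℕ.+-comm 1 i)) (π^-+ i 1 x)

  π^-injective : ∀ i → Injective _≡_ _≡_ (π^ i)
  π^-injective zero    eq = eq
  π^-injective (suc i) eq = π^-injective i (π-inj eq)

  π^-cancel : ∀ {i j x} → i ≤ j → π^ i x ≡ π^ j x → π^ (j ∸ i) x ≡ x
  π^-cancel {i} {j} {x} i≤j eq = sym (π^-injective i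
    (trans eq (trans (cong (λ k → π^ k x) (sym (ℕ.m+[n∸m]≡n i≤j))) (π^-+ i (j ∸ i) x))))

  opaque
    returns : ∀ x → ∃ λ k → k < N × π^ (suc k) x ≡ x
    returns x with Fin.pigeonhole (ℕ.n<1+n N) (λ i → e (π^ (toℕ i) x))
    ... | i , j , i<j , eq = k , k<N ,
      subst (λ d → π^ d x ≡ x) k≡ (π^-cancel (ℕ.<⇒≤ i<j) (e-inj eq))
      where
      k : ℕ
      k = toℕ j ∸ suc (toℕ i)
      k≡ : toℕ j ∸ toℕ i ≡ suc k
      k≡ = trans (cong (_∸ toℕ i) (sym (ℕ.m+[n∸m]≡n i<j)))
                 (trans (cong (_∸ toℕ i) (sym (ℕ.+-suc (toℕ i) k))) (ℕ.m+n∸m≡n (toℕ i) (suc k)))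
      k<N : k < N
      k<N = ℕ.≤-trans (ℕ.≤-reflexive (sym k≡)) (ℕ.≤-trans (ℕ.m∸n≤m (toℕ j) (toℕ i)) (s≤s⁻¹ (Fin.toℕ<n j)))

    leastReturn : ∀ x → ∃ λ m → m < N × π^ (suc m) x ≡ x × (∀ i → i < m → π^ (suc i) x ≢ x)
    leastReturn x with returns x
    ... | k , k<N , eq with leastWitness (λ i → π^ (suc i) x ≟ᴬ x) k eq
    ...   | m , m≤k , rest = m , ℕ.≤-<-trans m≤k k<N , rest

  opaque
    period : A → ℕ
    period x = suc (proj₁ (leastReturn x))

    period≤N : ∀ x → period x ≤ N
    period≤N x = proj₁ (proj₂ (leastReturn x))

    period>0 : ∀ x → 0 < period x
    period>0 x = z<s

    π^-period : ∀ x → π^ (period x) x ≡ x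
    π^-period x = proj₁ (proj₂ (proj₂ (leastReturn x)))

    not-earlier : ∀ {x} i → 0 < i → i < period x → π^ i x ≢ x
    not-earlier {x} (suc i) _ i<d = proj₂ (proj₂ (proj₂ (leastReturn x))) i (s≤s⁻¹ i<d)

  private
    π^-injective-<≤ : ∀ {x i j} → j < period x → i ≤ j → π^ i x ≡ π^ j x → i ≡ j
    π^-injective-<≤ {x} {i} {j} j<d i≤j eq with ℕ.m≤n⇒m<n∨m≡n i≤j
    ... | inj₂ i≡j = i≡j
    ... | inj₁ i<j = contradiction (π^-cancel i≤j eq)
                       (not-earlier (j ∸ i) (ℕ.m<n⇒0<n∸m i<j) (ℕ.≤-<-trans (ℕ.m∸n≤m j i) j<d))

  π^-injective-< : ∀ {x i j} → i < period x → j < period x → π^ i x ≡ π^ j x → i ≡ j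
  π^-injective-< {i = i} {j} i<d j<d eq with ℕ.≤-total i j
  ... | inj₁ i≤j = π^-injective-<≤ j<d i≤j eq
  ... | inj₂ j≤i = sym (π^-injective-<≤ i<d j≤i (sym eq))

  opaque
    π^-mod : ∀ x a → ∃ λ i → i < period x × π^ a x ≡ π^ i x
    π^-mod x zero = 0 , period>0 x , refl
    π^-mod x (suc a) with π^-mod x a
    ... | i , i<d , eq with ℕ.m≤n⇒m<n∨m≡n i<d
    ...   | inj₁ 1+i<d = suc i , 1+i<d , cong π eq
    ...   | inj₂ 1+i≡d = 0 , period>0 x ,
      trans (cong π eq) (trans (cong (λ k → π^ k x) 1+i≡d) (π^-period x))

    π^-return : ∀ x i → ∃ λ j → π^ j (π^ i x) ≡ x
    π^-return x i with π^-mod x i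
    ... | i′ , i′<d , eq = d ∸ i′ , (begin
      π^ (d ∸ i′) (π^ i x)  ≡⟨ cong (π^ (d ∸ i′)) eq ⟩
      π^ (d ∸ i′) (π^ i′ x) ≡⟨ π^-+ (d ∸ i′) i′ x ⟨
      π^ (d ∸ i′ + i′) x    ≡⟨ cong (λ k → π^ k x) (ℕ.m∸n+n≡m (ℕ.<⇒≤ i′<d)) ⟩
      π^ d x                ≡⟨ π^-period x ⟩
      x                     ∎)
      where
      open ≡-Reasoning
      d : ℕ
      d = period x

  private
    closer : (x y : A) → A
    closer x y with toℕ (e x) ≤? toℕ (e y)
    ... | yes _ = x
    ... | no  _ = y

    closer-≤ : ∀ x y → toℕ (e (closer x y)) ≤ toℕ (e x) × toℕ (e (closer x y)) ≤ toℕ (e y)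
    closer-≤ x y with toℕ (e x) ≤? toℕ (e y)
    ... | yes x≤y = ℕ.≤-refl , x≤y
    ... | no  x≰y = ℕ.≰⇒≥ x≰y , ℕ.≤-refl

    closer-elim : ∀ (P : A → Set) {x y} → P x → P y → P (closer x y)
    closer-elim P {x} {y} px py with toℕ (e x) ≤? toℕ (e y)
    ... | yes _ = px
    ... | no  _ = py

  opaque
    best : ℕ → A → A
    best zero    x = x
    best (suc k) x = closer (best k x) (π^ (suc k) x)

    best-≤ : ∀ k x i → i ≤ k → toℕ (e (best k x)) ≤ toℕ (e (π^ i x))
    best-≤ zero    x zero _ = ℕ.≤-refl
    best-≤ (suc k) x i i≤k with closer-≤ (best k x) (π^ (suc k) x) | ℕ.m≤n⇒m<n∨m≡n i≤k
    ... | ≤b , _ | inj₁ i<1+k = ℕ.≤-trans ≤b (best-≤ k x i (s≤s⁻¹ i<1+k))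
    ... | _ , ≤π | inj₂ refl  = ≤π

    best-orbit : ∀ k x → ∃ λ i → π^ i x ≡ best k x
    best-orbit zero    x = 0 , refl
    best-orbit (suc k) x =
      closer-elim (λ y → ∃ λ i → π^ i x ≡ y) (best-orbit k x) (suc k , refl)

    -- The element of least code in the orbit of `x`; the iterates up to `N` suffice because periods
    -- are at most `N`. Lying in one orbit thereby becomes a decidable equation between
    -- representatives.
    canon : A → A
    canon = best N

    canon-orbit : ∀ x → ∃ λ i → π^ i x ≡ canon x
    canon-orbit = best-orbit N

    canon-≤ : ∀ x i → toℕ (e (canon x)) ≤ toℕ (e (π^ i x))
    canon-≤ x i with π^-mod x i
    ... | j , j<d , eq = subst (λ y → toℕ (e (canon x)) ≤ toℕ (e y)) (sym eq)
                           (best-≤ N x j (ℕ.≤-trans (ℕ.<⇒≤ j<d) (period≤N x)))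

  canon-π : ∀ x → canon (π x) ≡ canon x
  canon-π x = e-inj (Fin.toℕ-injective (ℕ.≤-antisym ≤₁ ≤₂))
    where
    ≤₁ : toℕ (e (canon (π x))) ≤ toℕ (e (canon x))
    ≤₁ with canon-orbit x | π^-return x 1
    ... | i , eq | j , eq′ = subst (λ y → toℕ (e (canon (π x))) ≤ toℕ (e y))
      (trans (π^-+ i j (π x)) (trans (cong (π^ i) eq′) eq)) (canon-≤ (π x) (i + j))
    ≤₂ : toℕ (e (canon x)) ≤ toℕ (e (canon (π x)))
    ≤₂ with canon-orbit (π x)
    ... | i , eq = subst (λ y → toℕ (e (canon x)) ≤ toℕ (e y))
      (trans (π^-suc i x) eq) (canon-≤ x (suc i))

  canon-π^ : ∀ i x → canon (π^ i x) ≡ canon x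
  canon-π^ zero    x = refl
  canon-π^ (suc i) x = trans (canon-π (π^ i x)) (canon-π^ i x)

  canon-canon : ∀ x → canon (canon x) ≡ canon x
  canon-canon x with canon-orbit x
  ... | i , eq = trans (cong canon (sym eq)) (canon-π^ i x)

  opaque
    canon≡⇒orbit : ∀ {x y} → canon x ≡ canon y → ∃ λ i → i < period x × π^ i x ≡ y
    canon≡⇒orbit {x} {y} eq with canon-orbit x | canon-orbit y
    ... | i , eqx | j , eqy with π^-return y j
    ... | k , eqk with π^-mod x (k + i)
    ... | l , l<d , eql = l , l<d , trans (sym eql) (trans (π^-+ k i x)
            (trans (cong (π^ k) (trans eqx (trans eq (sym eqy)))) eqk))

-- Pairs of involutions and matchings

-- In the union of the two matchings `f` and `g`, the component of `x` is made up of the orbits of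
-- `x` and of `f x` under `f ∘ g`. The two orbits coincide if the component has a fixed point of `f`
-- or `g`, as on a path, and are disjoint on a cycle.
module TwoInvolutions {A : Set} {N : ℕ} (e : A → Fin N) (e-inj : Injective _≡_ _≡_ e)
                      (f g : A → A) (f-inv : Involutive f) (g-inv : Involutive g) where

  private
    π : A → A
    π = f ∘ g

    π-inj : Injective _≡_ _≡_ π
    π-inj = involutive⇒injective g g-inv ∘ involutive⇒injective f f-inv

  open Orbit e e-inj π π-inj public

  g-f : ∀ x → canon (g x) ≡ canon (f x)
  g-f x = trans (sym (canon-π (g x))) (cong (canon ∘ f) (g-inv x))

  -- The dihedral relation: conjugation by `f` inverts `π`. It is stated here without the inverse.
  f∘π^ : ∀ i x → π^ i (f (π^ i x)) ≡ f x
  f∘π^ zero    x = refl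
  f∘π^ (suc i) x = begin
    π^ (suc i) (f (π (π^ i x)))  ≡⟨ π^-suc i _ ⟩
    π^ i (f (g (f (f (g y)))))   ≡⟨ cong (π^ i ∘ f ∘ g) (f-inv (g y)) ⟩
    π^ i (f (g (g y)))           ≡⟨ cong (π^ i ∘ f) (g-inv y) ⟩
    π^ i (f y)                   ≡⟨ f∘π^ i x ⟩
    f x                          ∎
    where
    open ≡-Reasoning
    y = π^ i x

  canon-f : ∀ {x y} → canon x ≡ canon y → canon (f x) ≡ canon (f y)
  canon-f {x} eq with canon≡⇒orbit eq
  ... | i , _ , refl = trans (cong canon (sym (f∘π^ i x))) (canon-π^ i _)

  -- The component of a fixed point `w` of `f` is the single orbit of `w`: `f` maps orbits to orbits
  -- and fixes `w`, and `g` then stays inside by `g-f`. It is a path that starts at `w`.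
  module Trace {w : A} (fw : f w ≡ w) where

    f-closed : ∀ {v} → canon v ≡ canon w → canon (f v) ≡ canon w
    f-closed eq = trans (canon-f eq) (cong canon fw)

    g-closed : ∀ {v} → canon v ≡ canon w → canon (g v) ≡ canon w
    g-closed eq = trans (g-f _) (f-closed eq)

    -- If f fixes w and πⁱ w, then π²ⁱ w = w.
    half-period : ∀ {i} → i < period w → π^ i w ≢ w → f (π^ i w) ≡ π^ i w → i + i ≡ period w
    half-period {i} i<d ≢w fix with i + i <? period w
    ... | yes 2i<d = contradiction (cong (λ k → π^ k w) i≡0) ≢w
      where
      2i≡ : π^ (i + i) w ≡ w
      2i≡ = trans (π^-+ i i w) (trans (cong (π^ i) (sym fix)) (trans (f∘π^ i w) fw))
      i≡0 : i ≡ 0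
      i≡0 = ℕ.m+n≡0⇒m≡0 i (π^-injective-< 2i<d (period>0 w) 2i≡)
    ... | no 2i≮d = ℕ.≤-antisym (ℕ.m∸n≡0⇒m≤n r≡0) d≤2i
      where
      d = period w
      d≤2i : d ≤ i + i
      d≤2i = ℕ.≮⇒≥ 2i≮d
      r<d : i + i ∸ d < d
      r<d = ℕ.+-cancelˡ-< d _ d (subst (_< d + d) (sym (ℕ.m+[n∸m]≡n d≤2i)) (ℕ.+-mono-< i<d i<d))
      r≡ : π^ (i + i ∸ d) w ≡ w
      r≡ = begin
        π^ (i + i ∸ d) w          ≡⟨ cong (π^ (i + i ∸ d)) (π^-period w) ⟨
        π^ (i + i ∸ d) (π^ d w)   ≡⟨ π^-+ (i + i ∸ d) d w ⟨
        π^ (i + i ∸ d + d) w      ≡⟨ cong (λ k → π^ k w) (ℕ.m∸n+n≡m d≤2i) ⟩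
        π^ (i + i) w              ≡⟨ π^-+ i i w ⟩
        π^ i (π^ i w)             ≡⟨ cong (π^ i) fix ⟨
        π^ i (f (π^ i w))         ≡⟨ f∘π^ i w ⟩
        f w                       ≡⟨ fw ⟩
        w                         ∎
        where open ≡-Reasoning
      r≡0 : i + i ∸ d ≡ 0
      r≡0 = π^-injective-< r<d (period>0 w) r≡

    -- By `half-period` any further fixed point of `f` is the iterate halfway round the orbit of
    -- `w`.
    endpoint-unique : ∀ {u v} → canon u ≡ canon w → f u ≡ u → u ≢ w →
                      canon v ≡ canon w → f v ≡ v → v ≢ w → u ≡ v
    endpoint-unique cu fu u≢w cv fv v≢w with canon≡⇒orbit (sym cu) | canon≡⇒orbit (sym cv)
    ... | i , i<d , refl | j , j<d , refl =
      cong (λ k → π^ k w) (double-injective (trans (half-period i<d u≢w fu) (sym (half-period j<d v≢w fv))))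
      where
      double-injective : i + i ≡ j + j → i ≡ j
      double-injective eq with ℕ.<-cmp i j
      ... | tri< i<j _ _ = contradiction eq (ℕ.<⇒≢ (ℕ.+-mono-< i<j i<j))
      ... | tri≈ _ i≡j _ = i≡j
      ... | tri> _ _ j<i = contradiction (sym eq) (ℕ.<⇒≢ (ℕ.+-mono-< j<i j<i))

  module _ (f-free : ∀ x → f x ≢ x) (g-free : ∀ x → g x ≢ x) where

    private
      -- Cancelling `π` turns an equation for `i + 2` and `x` into one for `i` and `π x`. What
      -- remains in the end is a fixed point of `g` or of `f`.
      g∉orbit : ∀ i x → π^ i x ≢ g x
      g∉orbit zero          x eq = g-free x (sym eq)
      g∉orbit (suc zero)    x eq = f-free (g x) eq
      g∉orbit (suc (suc i)) x eq = g∉orbit i (π x)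
        (π-inj (begin
          π (π^ i (π x))              ≡⟨ cong π (π^-suc i x) ⟨
          π (π (π^ i x))              ≡⟨ eq ⟩
          g x                         ≡⟨ f-inv (g x) ⟨
          f (f (g x))                 ≡⟨ cong f (g-inv (f (g x))) ⟨
          f (g (g (f (g x))))         ∎))
        where open ≡-Reasoning

      -- Without fixed points a component splits into two different orbits, which both `f` and `g`
      -- interchange. Comparing the codes of their representatives gives them different colours.
      colour : A → Bool
      colour x = toℕ (e (canon x)) <ᵇ toℕ (e (canon (g x)))

      flips : ∀ a b → a ≢ b → (a <ᵇ b) ≡ not (b <ᵇ a)
      flips zero    zero    a≢b = contradiction refl a≢b
      flips zero    (suc b) a≢b = refl
      flips (suc a) zero    a≢b = refl
      flips (suc a) (suc b) a≢b = flips a b (a≢b ∘ cong suc)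

      flipped : ∀ x y → canon y ≡ canon (g x) → canon (g y) ≡ canon x → colour y ≢ colour x
      flipped x y eq₁ eq₂ c≡ = not-¬ (sym c≡)
        (trans (flips _ _ distinct)
               (cong₂ (λ a b → not (toℕ (e a) <ᵇ toℕ (e b))) (sym eq₁) (sym eq₂)))
        where
        distinct : toℕ (e (canon x)) ≢ toℕ (e (canon (g x)))
        distinct eq with canon≡⇒orbit (e-inj (Fin.toℕ-injective eq))
        ... | i , _ , eq′ = g∉orbit i x eq′

    opaque
      freeColouring : ∃ λ (c : A → Bool) → ∀ x → c (f x) ≢ c x × c (g x) ≢ c x
      freeColouring = colour , λ x →
         flipped x (f x) (sym (g-f x))
           (trans (g-f (f x)) (cong canon (f-inv x)))
       , flipped x (g x) refl (cong canon (g-inv x))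

bit : Bool → Fin 2
bit false = zero
bit true  = suc zero

bit-injective : Injective _≡_ _≡_ bit
bit-injective {false} {false} _ = refl
bit-injective {true}  {true}  _ = refl

module _ {A : Set} {N : ℕ} (e : A → Fin N) (e-inj : Injective _≡_ _≡_ e) where

  encode₂ : A × Bool → Fin (N * 2)
  encode₂ (x , s) = combine (e x) (bit s)

  encode₂-injective : Injective _≡_ _≡_ encode₂
  encode₂-injective {x , s} {y , t} eq with Fin.combine-injective (e x) (bit s) (e y) (bit t) eq
  ... | eq₁ , eq₂ = cong₂ _,_ (e-inj eq₁) (bit-injective eq₂)

  private
    _≟_ : DecidableEquality A
    x ≟ y = map′ e-inj (cong e) (e x Fin.≟ e y)

    -- Pairing the two copies of each fixed point removes all fixed points.
    lift : (A → A) → A × Bool → A × Bool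
    lift f (x , s) with f x ≟ x
    ... | yes _ = x , not s
    ... | no  _ = f x , s

    lift-involutive : ∀ f → Involutive f → Involutive (lift f)
    lift-involutive f inv (x , s) with f x ≟ x
    ... | yes fx≡x with f x ≟ x
    ...   | yes _   = cong (x ,_) (not-involutive s)
    ...   | no fx≢x = contradiction fx≡x fx≢x
    lift-involutive f inv (x , s) | no fx≢x with f (f x) ≟ f x
    ...   | yes eq = contradiction (trans (sym eq) (inv x)) fx≢x
    ...   | no  _  = cong (_, s) (inv x)

    lift-free : ∀ f x → lift f x ≢ x
    lift-free f (x , s) eq with f x ≟ x
    ... | yes _   = not-¬ refl (sym (cong proj₂ eq))
    ... | no fx≢x = fx≢x (cong proj₁ eq)

    lift-moved : ∀ f {x} s → f x ≢ x → lift f (x , s) ≡ (f x , s)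
    lift-moved f {x} s fx≢x with f x ≟ x
    ... | yes fx≡x = contradiction fx≡x fx≢x
    ... | no  _    = refl

  -- After `lift` there are no fixed points on the two copies of `A`. A moved point stays in its
  -- copy, so the colours of the copy `false` can be used.
  involutionColouring : ∀ {f g} → Involutive f → Involutive g →
    ∃ λ (c : A → Bool) → (∀ x → f x ≢ x → c (f x) ≢ c x) × (∀ x → g x ≢ x → c (g x) ≢ c x)
  involutionColouring {f} {g} f-inv g-inv
    with TwoInvolutions.freeColouring encode₂ encode₂-injective (lift f) (lift g)
           (lift-involutive f f-inv) (lift-involutive g g-inv) (lift-free f) (lift-free g)
  ... | c , proper = (λ x → c (x , false)) ,
    (λ x fx≢x → subst (λ y → c y ≢ c (x , false)) (lift-moved f false fx≢x)
                      (proj₁ (proper (x , false)))) ,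
    (λ x gx≢x → subst (λ y → c y ≢ c (x , false)) (lift-moved g false gx≢x)
                      (proj₂ (proper (x , false))))

record Matching {A : Set} (R : A → A → Set) : Set where
  field
    symmetric   : Symmetric R
    irreflexive : Irreflexive _≡_ R
    unique      : ∀ {x y z} → R x y → R x z → y ≡ z
    partner?    : ∀ x → Dec (∃ (R x))

  mate : A → A
  mate x with partner? x
  ... | yes (y , _) = y
  ... | no  _       = x

  mate-R : ∀ {x y} → R x y → mate x ≡ y
  mate-R {x} {y} xy with partner? x
  ... | yes (z , xz) = unique xz xy
  ... | no ¬xy       = contradiction (y , xy) ¬xy

  mate-cases : ∀ x → R x (mate x) ⊎ (mate x ≡ x × ¬ ∃ (R x))
  mate-cases x with partner? x
  ... | yes (_ , xy) = inj₁ xy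
  ... | no  ¬xy      = inj₂ (refl , ¬xy)

  mate-involutive : Involutive mate
  mate-involutive x with mate-cases x
  ... | inj₁ xy       = mate-R (symmetric xy)
  ... | inj₂ (eq , _) = trans (cong mate eq) eq

-- The union of two matchings is bipartite. This yields both the orientation of the graph and the
-- second bit of the final colouring.
matchingsColouring : ∀ {A : Set} {N} (e : A → Fin N) → Injective _≡_ _≡_ e →
  ∀ {R S : A → A → Set} → Matching R → Matching S →
  ∃ λ (c : A → Bool) → (∀ {x y} → R x y → c x ≢ c y) × (∀ {x y} → S x y → c x ≢ c y)
matchingsColouring {A} e e-inj M₁ M₂
  with involutionColouring e e-inj (Matching.mate-involutive M₁) (Matching.mate-involutive M₂)
... | c , proper₁ , proper₂ = c , transfer M₁ proper₁ , transfer M₂ proper₂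
  where
  transfer : ∀ {R : A → A → Set} (M : Matching R) →
    (∀ x → Matching.mate M x ≢ x → c (Matching.mate M x) ≢ c x) → ∀ {x y} → R x y → c x ≢ c y
  transfer M proper {x} {y} xy eq = proper x
    (λ fix → Matching.irreflexive M (sym (trans (sym (Matching.mate-R M xy)) fix)) xy)
    (trans (cong c (Matching.mate-R M xy)) (sym eq))

-- Counting in finite sets

comprehension : ∀ {n} {P : Fin n → Set} → Decidable₁ P → Subset n
comprehension P? = tabulate (does ∘ P?)

∈-comprehension⁺ : ∀ {n} {P : Fin n → Set} (P? : Decidable₁ P) → ∀ {v} → P v → v ∈ comprehension P?
∈-comprehension⁺ P? {v} pv =
  lookup⇒[]= v _ (trans (lookup∘tabulate (does ∘ P?) v) (dec-true (P? v) pv))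

∈-comprehension⁻ : ∀ {n} {P : Fin n → Set} (P? : Decidable₁ P) → ∀ {v} → v ∈ comprehension P? → P v
∈-comprehension⁻ P? {v} v∈ with P? v | trans (sym (lookup∘tabulate (does ∘ P?) v)) ([]=⇒lookup v∈)
... | yes pv | _ = pv

enumerate : ∀ {n} (S : Subset n) → ∃ λ (f : Fin ∣ S ∣ → Fin n) →
  Injective _≡_ _≡_ f × (∀ i → f i ∈ S) × (∀ {v} → v ∈ S → ∃ λ i → f i ≡ v)
enumerate [] = (λ ()) , (λ { {()} }) , (λ ()) , (λ ())
enumerate (false ∷ S) with enumerate S
... | f , inj , into , onto = suc ∘ f , inj ∘ Fin.suc-injective , there ∘ into , onto′
  where
  onto′ : ∀ {v} → v ∈ false ∷ S → ∃ λ i → suc (f i) ≡ v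
  onto′ (there v∈) with onto v∈
  ... | i , eq = i , cong suc eq
enumerate {suc n} (true ∷ S) with enumerate S
... | f , inj , into , onto = g , g-inj , g-into , g-onto
  where
  g : Fin (suc ∣ S ∣) → Fin (suc n)
  g zero    = zero
  g (suc i) = suc (f i)
  g-inj : Injective _≡_ _≡_ g
  g-inj {zero}  {zero}  _  = refl
  g-inj {suc i} {suc j} eq = cong suc (inj (Fin.suc-injective eq))
  g-into : ∀ i → g i ∈ true ∷ S
  g-into zero    = here
  g-into (suc i) = there (into i)
  g-onto : ∀ {v} → v ∈ true ∷ S → ∃ λ i → g i ≡ v
  g-onto here = zero , refl
  g-onto (there v∈) with onto v∈
  ... | i , eq = suc i , cong suc eq

injective⇒≤∣S∣ : ∀ {n k} (S : Subset n) {f : Fin k → Fin n} → Injective _≡_ _≡_ f →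
                 (∀ i → f i ∈ S) → k ≤ ∣ S ∣
injective⇒≤∣S∣ S f-inj f∈S with enumerate S
... | g , _ , _ , onto = Fin.injective⇒≤ λ {i} {j} eq →
  f-inj (trans (sym (proj₂ (onto (f∈S i)))) (trans (cong g eq) (proj₂ (onto (f∈S j)))))

∣S∣≤ : ∀ {n k} (S : Subset n) {A : Set} {g : A → Fin k} (f : ∀ {v} → v ∈ S → A) →
  Injective _≡_ _≡_ g → (∀ {u v} (u∈ : u ∈ S) (v∈ : v ∈ S) → f u∈ ≡ f v∈ → u ≡ v) → ∣ S ∣ ≤ k
∣S∣≤ S f g-inj f-inj with enumerate S
... | h , h-inj , into , _ = Fin.injective⇒≤ λ {i} {j} eq → h-inj (f-inj (into i) (into j) (g-inj eq))

injective⇒≤length : ∀ {k} {A : Set} {xs : List A} {f : Fin k → A} → Injective _≡_ _≡_ f →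
                    (∀ i → f i List.∈ xs) → k ≤ length xs
injective⇒≤length {xs = xs} f-inj f∈xs = Fin.injective⇒≤ λ {i} {j} eq →
  f-inj (trans (lookup-index (f∈xs i)) (trans (cong (List.lookup xs) eq) (sym (lookup-index (f∈xs j)))))

∈-⋃ : ∀ {n} {v : Fin n} {S} {Ss : List (Subset n)} → S List.∈ Ss → v ∈ S → v ∈ ⋃ Ss
∈-⋃ (here refl) v∈S = x∈p∪q⁺ (inj₁ v∈S)
∈-⋃ (there S∈)  v∈S = x∈p∪q⁺ (inj₂ (∈-⋃ S∈ v∈S))

-- Graphs of maximum degree at most two

module _ {n : ℕ} (H : Graph (Fin n)) (Δ≤2 : Δ H ≤ 2) where

  ¬three-neighbours : ∀ {u a b c} → Adj H u a → Adj H u b → Adj H u c →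
                      a ≢ b → a ≢ c → ¬ b ≢ c
  ¬three-neighbours {u} {a} {b} {c} ua ub uc a≢b a≢c b≢c =
    ℕ.1+n≰n (ℕ.≤-trans (injective⇒≤∣S∣ (neighbours H u) f-inj f∈) (ℕ.≤-trans deg≤Δ Δ≤2))
    where
    deg≤Δ : ∣ neighbours H u ∣ ≤ Δ H
    deg≤Δ = All.lookup (xs≤max 0 _) (∈-map⁺ (λ v → ∣ neighbours H v ∣) (∈-allFin u))
    f : Fin 3 → Fin n
    f zero             = a
    f (suc zero)       = b
    f (suc (suc zero)) = c
    f-inj : Injective _≡_ _≡_ f
    f-inj {zero}             {zero}             _  = refl
    f-inj {zero}             {suc zero}         eq = contradiction eq a≢b
    f-inj {zero}             {suc (suc zero)}   eq = contradiction eq a≢c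
    f-inj {suc zero}         {zero}             eq = contradiction (sym eq) a≢b
    f-inj {suc zero}         {suc zero}         _  = refl
    f-inj {suc zero}         {suc (suc zero)}   eq = contradiction eq b≢c
    f-inj {suc (suc zero)}   {zero}             eq = contradiction (sym eq) a≢c
    f-inj {suc (suc zero)}   {suc zero}         eq = contradiction (sym eq) b≢c
    f-inj {suc (suc zero)}   {suc (suc zero)}   _  = refl
    f∈ : ∀ i → f i ∈ neighbours H u
    f∈ zero             = ∈-comprehension⁺ (adj? H u) ua
    f∈ (suc zero)       = ∈-comprehension⁺ (adj? H u) ub
    f∈ (suc (suc zero)) = ∈-comprehension⁺ (adj? H u) uc

  private
    earlier? : (u v : Fin n) → Dec (∃ λ v′ → Adj H u v′ × toℕ v′ < toℕ v)
    earlier? u v = Fin.any? λ v′ → adj? H u v′ ×-dec (v′ Fin.<? v)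

    -- Distinguishes the at most two neighbours of u: false for the first, true for the second.
    slot : Fin n → Fin n → Bool
    slot u v = does (earlier? u v)

    slot-< : ∀ {u v v′} → Adj H u v → Adj H u v′ → toℕ v < toℕ v′ → slot u v ≢ slot u v′
    slot-< {u} {v} {v′} uv uv′ v<v′ eq with earlier? u v
    ... | no ¬e = contradiction (trans eq (dec-true (earlier? u v′) (v , uv , v<v′))) λ ()
    ... | yes (w , uw , w<v) = ¬three-neighbours uw uv uv′
      (λ { refl → ℕ.<-irrefl refl w<v })
      (λ { refl → ℕ.<-irrefl refl (ℕ.<-trans w<v v<v′) })
      (λ { refl → ℕ.<-irrefl refl v<v′ })

    slot-injective : ∀ {u v v′} → Adj H u v → Adj H u v′ → slot u v ≡ slot u v′ → v ≡ v′
    slot-injective {u} {v} {v′} uv uv′ eq with ℕ.<-cmp (toℕ v) (toℕ v′)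
    ... | tri< v<v′ _ _ = contradiction eq (slot-< uv uv′ v<v′)
    ... | tri≈ _ v≡v′ _ = Fin.toℕ-injective v≡v′
    ... | tri> _ _ v′<v = contradiction (sym eq) (slot-< uv′ uv v′<v)

    -- A dart is one of the two places for an edge at a vertex. Joining the two darts of an edge and
    -- the two darts of a vertex gives two matchings, whose union follows the paths and cycles of
    -- `H`; a two-colouring of it directs each of them consistently.
    Dart : Set
    Dart = Fin n × Bool

    Linked : Dart → Dart → Set
    Linked (u , s) (v , t) = Adj H u v × s ≡ slot u v × t ≡ slot v u

    Opposite : Dart → Dart → Set
    Opposite (u , s) (v , t) = u ≡ v × s ≡ not t

    linked : Matching Linked
    linked = record
      { symmetric   = λ (uv , s≡ , t≡) → symm H uv , t≡ , s≡
      ; irreflexive = λ { refl (uu , _) → irrefl H refl uu }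
      ; unique      = λ { (uv , refl , refl) (uw , eq , refl) → uniq uv uw eq }
      ; partner?    = λ (u , s) → map′ (λ (v , uv , eq) → (v , slot v u) , uv , eq , refl)
          (λ ((v , t) , uv , eq , _) → v , uv , eq)
          (Fin.any? λ v → adj? H u v ×-dec (s Bool.≟ slot u v))
      }
      where
      uniq : ∀ {u v w} → Adj H u v → Adj H u w → slot u v ≡ slot u w → (v , slot v u) ≡ (w , slot w u)
      uniq {u} uv uw eq = cong (λ v → v , slot v u) (slot-injective uv uw eq)

    opposite : Matching Opposite
    opposite = record
      { symmetric   = λ { {_} {_ , t} (refl , refl) → refl , sym (Bool.not-involutive t) }
      ; irreflexive = λ { refl (_ , eq) → not-¬ refl eq }
      ; unique      = λ { (refl , eq) (refl , eq′) →
                          cong (_ ,_) (Bool.not-injective (trans (sym eq) eq′)) }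
      ; partner?    = λ (u , s) → yes ((u , not s) , refl , sym (Bool.not-involutive s))
      }

  Orientation : (Fin n → Fin n → Set) → Set
  Orientation Out = (∀ {u v} → Adj H u v → Out u v ⊎ Out v u)
    × (∀ {u v w} → Out u v → Out u w → v ≡ w) × (∀ {u v w} → Out u w → Out v w → u ≡ v)
    × (∀ u → Dec (∃ (Out u)))

  -- An edge leaves the end whose dart is coloured `true`. The other dart of that vertex is coloured
  -- `false`, so at most one edge leaves a vertex and, likewise, at most one enters it.
  orientation : ∃ Orientation
  orientation with matchingsColouring (encode₂ id id) (encode₂-injective id id) linked opposite
  ... | c , linked≢ , opposite≢ = Out , covers , out-unique , in-unique , out?
    where
    Out : Fin n → Fin n → Set
    Out u v = Adj H u v × c (u , slot u v) ≡ true

    same-slot : ∀ {u s t} → c (u , s) ≡ c (u , t) → s ≡ t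
    same-slot {s = s} {t} eq with s Bool.≟ t
    ... | yes s≡t = s≡t
    ... | no  s≢t = contradiction eq (opposite≢ (refl , ¬-not s≢t))

    end : ∀ {u v} → Out u v → c (v , slot v u) ≡ false
    end (uv , eq) = ¬-not (λ eq′ → linked≢ (uv , refl , refl) (trans eq (sym eq′)))

    covers : ∀ {u v} → Adj H u v → Out u v ⊎ Out v u
    covers {u} {v} uv with c (u , slot u v) in eq
    ... | true  = inj₁ (uv , refl)
    ... | false = inj₂ (symm H uv , ¬-not λ eq′ → linked≢ (uv , refl , refl) (trans eq (sym eq′)))

    out-unique : ∀ {u v w} → Out u v → Out u w → v ≡ w
    out-unique (uv , eq) (uw , eq′) = slot-injective uv uw (same-slot (trans eq (sym eq′)))

    in-unique : ∀ {u v w} → Out u w → Out v w → u ≡ v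
    in-unique uw vw = slot-injective (symm H (proj₁ uw)) (symm H (proj₁ vw))
      (same-slot (trans (end uw) (sym (end vw))))

    out? : ∀ u → Dec (∃ (Out u))
    out? u = Fin.any? λ v → adj? H u v ×-dec (c (u , slot u v) Bool.≟ true)

-- Extending a partial injection to a permutation

transpose-here : ∀ {n} (i j : Fin n) → Components.transpose i j i ≡ j
transpose-here i j rewrite dec-true (i Fin.≟ i) refl = refl

transpose-elsewhere : ∀ {n} {i j k : Fin n} → k ≢ i → k ≢ j → Components.transpose i j k ≡ k
transpose-elsewhere {i = i} {j} {k} k≢i k≢j
  rewrite dec-false (k Fin.≟ i) k≢i | dec-false (k Fin.≟ j) k≢j = refl

extendToPermutation : ∀ {n} {Out : Fin n → Fin n → Set} → (∀ u → Dec (∃ (Out u))) →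
  (∀ {u v w} → Out u v → Out u w → v ≡ w) → (∀ {u v w} → Out u w → Out v w → u ≡ v) →
  ∃ λ (σ : Permutation′ n) → ∀ {u v} → Out u v → σ ⟨$⟩ʳ u ≡ v
extendToPermutation {n} {Out} out? out-unique in-unique =
  let σ , ok = upTo n ℕ.≤-refl in σ , λ uv → ok uv (Fin.toℕ<n _)
  where
  upTo : ∀ k → k ≤ n → ∃ λ (σ : Permutation′ n) → ∀ {u v} → Out u v → toℕ u < k → σ ⟨$⟩ʳ u ≡ v
  upTo zero    _   = idₚ , λ _ ()
  upTo (suc k) k<n with upTo k (ℕ.<⇒≤ k<n)
  ... | σ , ok with out? (fromℕ< k<n)
  ...   | no ¬out = σ , λ {u} {v} uv u<1+k → [ ok uv , (λ u≡k → contradiction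
            (v , subst (λ z → Out z v) (Fin.toℕ-injective (trans u≡k (sym (Fin.toℕ-fromℕ< k<n)))) uv) ¬out) ]
            (ℕ.m≤n⇒m<n∨m≡n (s≤s⁻¹ u<1+k))
  ...   | yes (b , ab) = σ ∘ₚ transpose (σ ⟨$⟩ʳ a) b , ok′
    where
    a : Fin n
    a = fromℕ< k<n
    ok′ : ∀ {u v} → Out u v → toℕ u < suc k → Components.transpose (σ ⟨$⟩ʳ a) b (σ ⟨$⟩ʳ u) ≡ v
    ok′ {u} {v} uv u<1+k with ℕ.m≤n⇒m<n∨m≡n (s≤s⁻¹ u<1+k)
    ... | inj₂ u≡k with Fin.toℕ-injective (trans u≡k (sym (Fin.toℕ-fromℕ< k<n)))
    ...   | refl = trans (transpose-here (σ ⟨$⟩ʳ a) b) (out-unique ab uv)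
    ok′ {u} {v} uv u<1+k | inj₁ u<k = trans (transpose-elsewhere σu≢σa σu≢b) (ok uv u<k)
      where
      u≢a : u ≢ a
      u≢a refl = ℕ.<-irrefl (Fin.toℕ-fromℕ< k<n) u<k
      σu≢σa : σ ⟨$⟩ʳ u ≢ σ ⟨$⟩ʳ a
      σu≢σa eq = u≢a (trans (sym (inverseˡ σ)) (trans (cong (σ ⟨$⟩ˡ_) eq) (inverseˡ σ)))
      σu≢b : σ ⟨$⟩ʳ u ≢ b
      σu≢b eq = u≢a (in-unique uv (subst (Out a) (trans (sym eq) (ok uv u<k)) ab))

-- Every edge follows the permutation in one of the two directions, but a vertex and its image may
-- be non-adjacent, for instance where a path is closed up. Hence the predicate `Edge` below.
cyclicSuccessor : ∀ {n} (H : Graph (Fin n)) → Δ H ≤ 2 → ∃ λ (σ : Permutation′ n) →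
  ∀ {u v} → Adj H u v → v ≡ σ ⟨$⟩ʳ u ⊎ v ≡ σ ⟨$⟩ˡ u
cyclicSuccessor H Δ≤2 with orientation H Δ≤2
... | Out , covers , out-unique , in-unique , out? with extendToPermutation out? out-unique in-unique
... | σ , ok = σ , λ uv → [ inj₁ ∘ sym ∘ ok
  , (λ vu → inj₂ (trans (sym (inverseˡ σ)) (cong (σ ⟨$⟩ˡ_) (ok vu)))) ] (covers uv)

-- Matchings along the orbits of a permutation

parity-suc : ∀ k → parity (suc k) ≡ flip (parity k)
parity-suc k = trans (sym (Parity.⁻¹-involutive _)) (cong flip (Parity.suc-homo-⁻¹ k))

even⊎odd : ∀ k → parity k ≡ 0ℙ ⊎ parity k ≡ 1ℙ
even⊎odd k with parity k
... | 0ℙ = inj₁ refl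
... | 1ℙ = inj₂ refl

module Successor {n : ℕ} (σ : Permutation′ n) where

  s s⁻¹ : Fin n → Fin n
  s   = σ ⟨$⟩ʳ_
  s⁻¹ = σ ⟨$⟩ˡ_

  s-s⁻¹ : ∀ v → s (s⁻¹ v) ≡ v
  s-s⁻¹ v = inverseʳ σ

  s⁻¹-s : ∀ v → s⁻¹ (s v) ≡ v
  s⁻¹-s v = inverseˡ σ

  opaque
    s-injective : Injective _≡_ _≡_ s
    s-injective {u} {v} eq = trans (sym (s⁻¹-s u)) (trans (cong s⁻¹ eq) (s⁻¹-s v))

  open Orbit id id s s-injective public

  canon-s⁻¹ : ∀ v → canon (s⁻¹ v) ≡ canon v
  canon-s⁻¹ v = trans (sym (canon-π (s⁻¹ v))) (cong canon (s-s⁻¹ v))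

  private
    period-≤ : ∀ {x y} → canon x ≡ canon y → period x ≤ period y
    period-≤ {x} {y} eq with period x ℕ.≤? period y | canon≡⇒orbit (sym eq)
    ... | yes p≤q | _ = p≤q
    ... | no  p≰q | i , _ , refl = contradiction
      (π^-injective-< (ℕ.≰⇒> p≰q) (period>0 x) (begin
        π^ (period y) (π^ i y)  ≡⟨ π^-+ (period y) i y ⟨
        π^ (period y + i) y     ≡⟨ cong (λ k → π^ k y) (ℕ.+-comm (period y) i) ⟩
        π^ (i + period y) y     ≡⟨ π^-+ i (period y) y ⟩
        π^ i (π^ (period y) y)  ≡⟨ cong (π^ i) (π^-period y) ⟩
        π^ i y                  ∎))
      (ℕ.m<n⇒n≢0 (period>0 y))
      where
      open ≡-Reasoning

  period-cong : ∀ {x y} → canon x ≡ canon y → period x ≡ period y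
  period-cong eq = ℕ.≤-antisym (period-≤ eq) (period-≤ (sym eq))

  Along : (Fin n → Fin n) → Set
  Along m = ∀ v → m v ≡ v ⊎ m v ≡ s v ⊎ m v ≡ s⁻¹ v

  OneFixedPerOrbit : (Fin n → Fin n) → Set
  OneFixedPerOrbit m = ∀ {u v} → canon u ≡ canon v → m u ≡ u → m v ≡ v → u ≡ v

  module _ {Edge : Fin n → Set} (edge? : Decidable₁ Edge) where

    private
      opaque
        -- The starting point for numbering an orbit. If some step of the orbit is not an edge, the
        -- numbering begins right after such a step, so that the step closing the orbit is a missing
        -- edge.
        repOf : Fin n → Fin n
        repOf r with Fin.any? (λ y → (canon y Fin.≟ r) ×-dec ¬? (edge? y))
        ... | yes (y , _) = s y
        ... | no  _       = r

        rep : Fin n → Fin n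
        rep v = repOf (canon v)

        rep-cong : ∀ {u v} → canon u ≡ canon v → rep u ≡ rep v
        rep-cong = cong repOf

        rep-s : ∀ v → rep (s v) ≡ rep v
        rep-s v = cong repOf (canon-π v)

        canon-rep : ∀ v → canon (rep v) ≡ canon v
        canon-rep v with Fin.any? (λ y → (canon y Fin.≟ canon v) ×-dec ¬? (edge? y))
        ... | yes (y , eq , _) = trans (canon-π y) eq
        ... | no  _            = canon-canon v

        rep-break : ∀ {v y} → canon y ≡ canon v → ¬ Edge y → ∀ {u} → s u ≡ rep v → ¬ Edge u
        rep-break {v} {y} eq ¬ey su≡ with Fin.any? (λ y → (canon y Fin.≟ canon v) ×-dec ¬? (edge? y))
        ... | yes (z , _ , ¬ez) = subst (¬_ ∘ Edge) (s-injective (sym su≡)) ¬ez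
        ... | no  none          = contradiction (y , eq , ¬ey) none

      position : ∀ v → ∃ λ i → i < period (rep v) × π^ i (rep v) ≡ v
      position v = canon≡⇒orbit (canon-rep v)

      idx : Fin n → ℕ
      idx v = proj₁ (position v)

      idx-unique : ∀ {v i} → i < period (rep v) → π^ i (rep v) ≡ v → idx v ≡ i
      idx-unique {v} i<p eq =
        let _ , j<p , eq′ = position v in π^-injective-< j<p i<p (trans eq′ (sym eq))

      idx< : ∀ v → idx v < period (rep v)
      idx< v = proj₁ (proj₂ (position v))

      π^-idx : ∀ v → π^ (idx v) (rep v) ≡ v
      π^-idx v = proj₂ (proj₂ (position v))

      idx-last : ∀ {v} → s v ≡ rep v → suc (idx v) ≡ period (rep v)
      idx-last {v} sv≡ with ℕ.m≤n⇒m<n∨m≡n (idx< v)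
      ... | inj₂ 1+i≡p = 1+i≡p
      ... | inj₁ 1+i<p = contradiction
        (π^-injective-< 1+i<p (period>0 _) (trans (cong s (π^-idx v)) sv≡)) λ ()

      idx-suc : ∀ {v} → s v ≢ rep v → idx (s v) ≡ suc (idx v)
      idx-suc {v} sv≢ with ℕ.m≤n⇒m<n∨m≡n (idx< v)
      ... | inj₁ 1+i<p = idx-unique
        (subst (λ r → suc (idx v) < period r) (sym (rep-s v)) 1+i<p)
        (trans (cong (π^ (suc (idx v))) (rep-s v)) (cong s (π^-idx v)))
      ... | inj₂ 1+i≡p = contradiction
        (trans (sym (cong s (π^-idx v))) (trans (cong (λ k → π^ k (rep v)) 1+i≡p) (π^-period (rep v)))) sv≢

      odd⇒≢rep : ∀ {v} → parity (idx v) ≡ 1ℙ → v ≢ rep v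
      odd⇒≢rep {v} odd v≡ = contradiction
        (trans (sym odd) (cong parity (idx-unique (period>0 _) (sym v≡)))) λ ()

      -- Positions 0 and 1, 2 and 3, and so on are paired. The last inequality stops the final
      -- element of an odd orbit from being paired with the starting point.
      Up : Fin n → Fin n → Set
      Up u v = v ≡ s u × parity (idx u) ≡ 0ℙ × s u ≢ rep u

      up? : ∀ u v → Dec (Up u v)
      up? u v = (v Fin.≟ s u) ×-dec (parity (idx u) Parity.≟ 0ℙ) ×-dec ¬? (s u Fin.≟ rep u)

      Up-odd : ∀ {u v} → Up u v → parity (idx v) ≡ 1ℙ
      Up-odd {u} (refl , even , su≢) =
        trans (cong parity (idx-suc su≢)) (trans (parity-suc (idx u)) (cong flip even))

      pairing : Matching (λ u v → Up u v ⊎ Up v u)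
      pairing = record
        { symmetric   = [ inj₂ , inj₁ ]
        ; irreflexive = λ { refl (inj₁ up) → clash up up ; refl (inj₂ up) → clash up up }
        ; unique      = uniq
        ; partner?    = λ u → Fin.any? λ v → up? u v ⊎-dec up? v u
        }
        where
        clash : ∀ {u v w : Fin n} → Up u v → Up v w → ∀ {A : Set} → A
        clash up (_ , even , _) = contradiction (trans (sym (Up-odd up)) even) λ ()
        uniq : ∀ {x y z} → Up x y ⊎ Up y x → Up x z ⊎ Up z x → y ≡ z
        uniq (inj₁ (refl , _)) (inj₁ (refl , _)) = refl
        uniq (inj₁ xy) (inj₂ zx) = clash zx xy
        uniq (inj₂ yx) (inj₁ xz) = clash yx xz
        uniq (inj₂ (eq , _)) (inj₂ (eq′ , _)) = s-injective (trans (sym eq) eq′)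

      open Matching pairing

      mate-last : ∀ {v} → mate v ≡ v → parity (idx v) ≡ 0ℙ × s v ≡ rep v
      mate-last {v} fix with mate-cases v
      ... | inj₁ r = contradiction r (irreflexive (sym fix))
      ... | inj₂ (_ , lonely) with even⊎odd (idx v)
      ...   | inj₁ eq = eq , decidable-stable (s v Fin.≟ rep v) λ sv≢ → lonely (s v , inj₁ (refl , eq , sv≢))
      ...   | inj₂ eq = contradiction (s⁻¹ v , inj₂ (sym (s-s⁻¹ v) , even , s≢)) lonely
        where
        s≢ : s (s⁻¹ v) ≢ rep (s⁻¹ v)
        s≢ eq′ = odd⇒≢rep eq (trans (sym (s-s⁻¹ v))
          (trans eq′ (trans (sym (rep-s (s⁻¹ v))) (cong rep (s-s⁻¹ v)))))
        even : parity (idx (s⁻¹ v)) ≡ 0ℙ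
        even = Parity.⁻¹-injective (trans (sym (parity-suc (idx (s⁻¹ v))))
          (trans (cong parity (sym (idx-suc s≢))) (trans (cong (parity ∘ idx) (s-s⁻¹ v)) eq)))

    -- Only the last position can stay unmatched, and it does so when its index is even, that is, in
    -- an orbit of odd period. By the choice of `rep` it is followed by a missing edge if the orbit
    -- has any.
    orbitMatching : ∃ λ m → Involutive m × Along m × OneFixedPerOrbit m ×
      (∀ {v} → m v ≡ v → parity (period v) ≡ 1ℙ × (∀ {y} → canon y ≡ canon v → ¬ Edge y → ¬ Edge v))
    orbitMatching = mate , mate-involutive , along , one , last
      where
      along : Along mate
      along v with mate-cases v
      ... | inj₂ (fix , _)       = inj₁ fix
      ... | inj₁ (inj₁ (eq , _)) = inj₂ (inj₁ eq)
      ... | inj₁ (inj₂ (eq , _)) = inj₂ (inj₂ (trans (sym (s⁻¹-s (mate v))) (cong s⁻¹ (sym eq))))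
      one : OneFixedPerOrbit mate
      one {u} {v} eq fu fv = s-injective (trans (proj₂ (mate-last fu))
        (trans (rep-cong eq) (sym (proj₂ (mate-last fv)))))
      last : ∀ {v} → mate v ≡ v →
        parity (period v) ≡ 1ℙ × (∀ {y} → canon y ≡ canon v → ¬ Edge y → ¬ Edge v)
      last {v} fix with mate-last fix
      ... | even , sv≡ = trans (cong parity (trans (period-cong (sym (canon-rep v))) (sym (idx-last sv≡))))
                               (trans (parity-suc (idx v)) (cong flip even))
                         , λ eq ¬ey → rep-break eq ¬ey sv≡

odd⇒%2≡1 : ∀ k → parity k ≡ 1ℙ → k % 2 ≡ 1
odd⇒%2≡1 (suc zero)    _  = refl
odd⇒%2≡1 (suc (suc k)) eq = odd⇒%2≡1 k eq

half : ∀ k → parity k ≡ 0ℙ → ∃ λ t → t + t ≡ k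
half zero          _  = 0 , refl
half (suc (suc k)) eq with half k eq
... | t , refl = suc t , cong suc (ℕ.+-suc t t)

-- Rotating a matching along an odd orbit

module _ {A B : Set} (_≟_ : DecidableEquality B) (label : A → B) where

  -- Otherwise the labels would pair off the elements of a list of odd length.
  loner : ∀ xs → Unique xs → parity (length xs) ≡ 1ℙ →
    (∀ {x y z} → x List.∈ xs → y List.∈ xs → z List.∈ xs → label y ≡ label x → label z ≡ label x →
       y ≢ x → z ≢ x → y ≡ z) →
    ∃ λ x → x List.∈ xs × (∀ {y} → y List.∈ xs → label y ≡ label x → y ≡ x)
  loner xs = go (length xs) xs ℕ.≤-refl
    where
    go : ∀ k xs → length xs ≤ k → Unique xs → parity (length xs) ≡ 1ℙ →
      (∀ {x y z} → x List.∈ xs → y List.∈ xs → z List.∈ xs → label y ≡ label x → label z ≡ label x →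
         y ≢ x → z ≢ x → y ≡ z) →
      ∃ λ x → x List.∈ xs × (∀ {y} → y List.∈ xs → label y ≡ label x → y ≡ x)
    go (suc k) (x ∷ xs) (s≤s len≤k) uniq@(_ ∷ _) odd two with any? (λ y → label y ≟ label x) xs
    ... | no ¬any = x , here refl , λ
      { (here eq) _ → eq
      ; (there y∈) eq → contradiction (lose y∈ eq) ¬any }
    ... | yes any = remove (find any)
      where
      remove : (∃ λ y → y List.∈ xs × label y ≡ label x) → _
      remove (y , y∈ , y~x) with ∈-∃++ y∈
      ... | as , bs , refl = result
        where
        perm : xs ↭ y ∷ as ++ bs
        perm = shift y as bs
        uniq′ : Unique (x ∷ y ∷ as ++ bs)
        uniq′ = SetoidPermutation.Unique-resp-↭ (setoid A) (↭⇒↭ₛ (↭-prep x perm)) uniq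
        len : length xs ≡ suc (length (as ++ bs))
        len = ↭-length perm
        back : ∀ {z} → z List.∈ as ++ bs → z List.∈ x ∷ xs
        back z∈ = there (∈-resp-↭ (↭-sym perm) (there z∈))
        result : ∃ λ f → f List.∈ x ∷ xs × (∀ {z} → z List.∈ x ∷ xs → label z ≡ label f → z ≡ f)
        result with uniq′
        ... | (x≢y ∷ x∉) ∷ (y∉ ∷ uniq″) with
          go k (as ++ bs) (ℕ.≤-trans (ℕ.n≤1+n _) (subst (_≤ k) len len≤k)) uniq″
             (subst (λ l → parity (suc l) ≡ 1ℙ) len odd)
             (λ a∈ b∈ c∈ → two (back a∈) (back b∈) (back c∈))
        ...   | f , f∈ , alone = f , back f∈ , alone′
          where
          f≢x : f ≢ x
          f≢x eq = All.lookup x∉ f∈ (sym eq)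
          f≢y : f ≢ y
          f≢y eq = All.lookup y∉ f∈ (sym eq)
          clash : label x ≡ label f → ∀ {C : Set} → C
          clash x~f = contradiction
            (two (here refl) (there y∈) (back f∈) y~x (sym x~f) (≢-sym x≢y) f≢x) (≢-sym f≢y)
          alone′ : ∀ {z} → z List.∈ x ∷ xs → label z ≡ label f → z ≡ f
          alone′ (here refl) z~f = clash z~f
          alone′ (there z∈) z~f with ∈-resp-↭ perm z∈
          ... | here refl = clash (trans (sym y~x) z~f)
          ... | there z∈′ = alone z∈′ z~f

does-closed : ∀ {A : Set} {P : A → Set} (P? : Decidable₁ P) {f} → Involutive f →
  (∀ {v} → P v → P (f v)) → ∀ v → does (P? (f v)) ≡ does (P? v)
does-closed {P = P} P? {f} inv closed v with P? v
... | yes pv = dec-true (P? (f v)) (closed pv)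
... | no ¬pv = dec-false (P? (f v)) λ pfv → ¬pv (subst P (inv v) (closed pfv))

module _ {n : ℕ} where

  attach : (Fin n → Fin n) → Fin n → Fin n → Fin n → Fin n
  attach f a b v with v Fin.≟ a
  ... | yes _ = b
  ... | no  _ with v Fin.≟ b
  ...   | yes _ = a
  ...   | no  _ = f v

  detach : (Fin n → Fin n) → Fin n → Fin n → Fin n
  detach f a v with v Fin.≟ a
  ... | yes _ = v
  ... | no  _ with v Fin.≟ f a
  ...   | yes _ = v
  ...   | no  _ = f v

  attach-left : ∀ f a b → attach f a b a ≡ b
  attach-left f a b with a Fin.≟ a
  ... | yes _   = refl
  ... | no  a≢a = contradiction refl a≢a

  attach-right : ∀ f a b → attach f a b b ≡ a
  attach-right f a b with b Fin.≟ a
  ... | yes b≡a = b≡a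
  ... | no  _ with b Fin.≟ b
  ...   | yes _   = refl
  ...   | no  b≢b = contradiction refl b≢b

  attach-elsewhere : ∀ f {a b v} → v ≢ a → v ≢ b → attach f a b v ≡ f v
  attach-elsewhere f {a} {b} {v} v≢a v≢b with v Fin.≟ a
  ... | yes v≡a = contradiction v≡a v≢a
  ... | no  _ with v Fin.≟ b
  ...   | yes v≡b = contradiction v≡b v≢b
  ...   | no  _   = refl

  attach-elim : ∀ (P : Fin n → Fin n → Set) f {a b} → P a b → P b a →
    (∀ v → v ≢ a → v ≢ b → P v (f v)) → ∀ v → P v (attach f a b v)
  attach-elim P f {a} {b} pab pba pf v with v Fin.≟ a
  ... | yes refl = pab
  ... | no  v≢a with v Fin.≟ b
  ...   | yes refl = pba
  ...   | no  v≢b  = pf v v≢a v≢b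

  attach-involutive : ∀ {f a b} → Involutive f → f a ≡ a → f b ≡ b → Involutive (attach f a b)
  attach-involutive {f} {a} {b} inv fa fb = attach-elim (λ v w → attach f a b w ≡ v) f
    (attach-right f a b) (attach-left f a b)
    λ v v≢a v≢b → trans (attach-elsewhere f
      (λ eq → v≢a (trans (sym (inv v)) (trans (cong f eq) fa)))
      (λ eq → v≢b (trans (sym (inv v)) (trans (cong f eq) fb)))) (inv v)

  detach-fixed : ∀ f a → detach f a a ≡ a
  detach-fixed f a with a Fin.≟ a
  ... | yes _   = refl
  ... | no  a≢a = contradiction refl a≢a

  detach-fixed′ : ∀ f a → detach f a (f a) ≡ f a
  detach-fixed′ f a with f a Fin.≟ a
  ... | yes _ = refl
  ... | no  _ with f a Fin.≟ f a
  ...   | yes _     = refl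
  ...   | no  fa≢fa = contradiction refl fa≢fa

  detach-elsewhere : ∀ f {a v} → v ≢ a → v ≢ f a → detach f a v ≡ f v
  detach-elsewhere f {a} {v} v≢a v≢fa with v Fin.≟ a
  ... | yes v≡a = contradiction v≡a v≢a
  ... | no  _ with v Fin.≟ f a
  ...   | yes v≡fa = contradiction v≡fa v≢fa
  ...   | no  _    = refl

  detach-elim : ∀ (P : Fin n → Fin n → Set) f {a} → P a a → P (f a) (f a) →
    (∀ v → v ≢ a → v ≢ f a → P v (f v)) → ∀ v → P v (detach f a v)
  detach-elim P f {a} pa pfa pf v with v Fin.≟ a
  ... | yes refl = pa
  ... | no  v≢a with v Fin.≟ f a
  ...   | yes refl = pfa
  ...   | no  v≢fa = pf v v≢a v≢fa

  detach-involutive : ∀ {f} a → Involutive f → Involutive (detach f a)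
  detach-involutive {f} a inv = detach-elim (λ v w → detach f a w ≡ v) f
    (detach-fixed f a) (detach-fixed′ f a)
    λ v v≢a v≢fa → trans (detach-elsewhere f
      (λ eq → v≢fa (trans (sym (inv v)) (cong f eq)))
      (λ eq → v≢a (involutive⇒injective f inv eq))) (inv v)

module Rotation {n : ℕ} (σ : Permutation′ n) (p : Fin n → Fin n) (p-inv : Involutive p) where

  open Successor σ

  -- `ℓ` is constant on the components of `m` and `p` together, each bit marking a union of
  -- components. Sides may therefore be exchanged according to any function of `ℓ`.
  record State (m : Fin n → Fin n) {k : ℕ} (ℓ : Fin n → Vec Bool k) : Set where
    field
      involutive : Involutive m
      along      : Along m
      oneFixed   : OneFixedPerOrbit m
      ℓ-m        : ∀ v → ℓ (m v) ≡ ℓ v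
      ℓ-p        : ∀ v → ℓ (p v) ≡ ℓ v

  along⇒canon : ∀ {m} → Along m → ∀ v → canon (m v) ≡ canon v
  along⇒canon along v with along v
  ... | inj₁ eq        = cong canon eq
  ... | inj₂ (inj₁ eq) = trans (cong canon eq) (canon-π v)
  ... | inj₂ (inj₂ eq) = trans (cong canon eq) (canon-s⁻¹ v)

  Separated : ∀ {k} → (Fin n → Vec Bool k) → Fin n → Set
  Separated ℓ v = ℓ v ≢ ℓ (s v) ⊎ ℓ v ≢ ℓ (s⁻¹ v)

  -- One orbit, with representative `c`, is settled. The fields `outside` and `refines` preserve
  -- what has been achieved on the other orbits.
  record Resolved (c : Fin n) (m₀ : Fin n → Fin n) {k₀} (ℓ₀ : Fin n → Vec Bool k₀) : Set where
    field
      m         : Fin n → Fin n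
      k         : ℕ
      ℓ         : Fin n → Vec Bool k
      state     : State m ℓ
      outside   : ∀ {v} → canon v ≢ c → m v ≡ m₀ v
      refines   : ∀ {u v} → ℓ₀ u ≢ ℓ₀ v → ℓ u ≢ ℓ v
      separated : ∀ {v} → canon v ≡ c → m v ≡ v → Separated ℓ v

  split-state : ∀ {m k} {ℓ : Fin n → Vec Bool k} {P : Fin n → Set} (P? : Decidable₁ P) →
    State m ℓ → (∀ {v} → P v → P (m v)) → (∀ {v} → P v → P (p v)) →
    State m (λ v → does (P? v) ∷ ℓ v)
  split-state P? st m-closed p-closed = record
    { involutive = involutive
    ; along      = along
    ; oneFixed   = oneFixed
    ; ℓ-m        = λ v → cong₂ _∷_ (does-closed P? involutive m-closed v) (ℓ-m v)
    ; ℓ-p        = λ v → cong₂ _∷_ (does-closed P? p-inv p-closed v) (ℓ-p v)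
    }
    where open State st

  split-separates : ∀ {k} (ℓ : Fin n → Vec Bool k) {P : Fin n → Set} (P? : Decidable₁ P) {u v} →
    P u → ¬ P v → does (P? u) ∷ ℓ u ≢ does (P? v) ∷ ℓ v
  split-separates ℓ P? {u} {v} pu ¬pv eq = contradiction
    (trans (sym (dec-true (P? u) pu)) (trans (∷-injectiveˡ eq) (dec-false (P? v) ¬pv))) λ ()

  module _ {c : Fin n} {m₀ : Fin n → Fin n} {k : ℕ} {ℓ : Fin n → Vec Bool k} (st₀ : State m₀ ℓ) where

    -- A set closed under `m` and `p` is a union of components and can be added as a new bit of the
    -- label. It has to contain exactly one of the unmatched vertex and a neighbour of it.
    split : ∀ {m} {P : Fin n → Set} (P? : Decidable₁ P) → State m ℓ →
      (∀ {v} → canon v ≢ c → m v ≡ m₀ v) →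
      (∀ {v} → P v → P (m v)) → (∀ {v} → P v → P (p v)) →
      (∀ {v} → canon v ≡ c → m v ≡ v →
         (P v × ¬ P (s v)) ⊎ (¬ P v × P (s⁻¹ v))) →
      Resolved c m₀ ℓ
    split {m} P? st outside m-closed p-closed sep = record
      { m = m ; k = suc k ; ℓ = λ v → does (P? v) ∷ ℓ v
      ; state     = split-state P? st m-closed p-closed
      ; outside   = outside
      ; refines   = λ ℓ≢ eq → ℓ≢ (∷-injectiveʳ eq)
      ; separated = separated
      }
      where
      separated : ∀ {v} → canon v ≡ c → m v ≡ v → Separated (λ v → does (P? v) ∷ ℓ v) v
      separated v∈ fix with sep v∈ fix
      ... | inj₁ (pv , ¬psv)  = inj₁ (split-separates ℓ P? pv ¬psv)
      ... | inj₂ (¬pv , psv)  = inj₂ (≢-sym (split-separates ℓ P? psv ¬pv))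

    module _ (3≤period : ∀ {v} → canon v ≡ c → 3 ≤ period v) where

      s≢ : ∀ {v} → canon v ≡ c → s v ≢ v
      s≢ {v} v∈ eq = contradiction
        (π^-injective-< {v} {1} {0} (ℕ.≤-trans (s≤s (s≤s z≤n)) (3≤period v∈)) (period>0 v) eq) λ ()

      ss≢ : ∀ {v} → canon v ≡ c → s (s v) ≢ v
      ss≢ {v} v∈ eq = contradiction
        (π^-injective-< {v} {2} {0} (3≤period v∈) (period>0 v) eq) λ ()

      data Step (w : Fin n) : Set where
        resolved : Resolved c m₀ ℓ → Step w
        moved    : (m : Fin n → Fin n) → State m ℓ → (∀ {v} → canon v ≢ c → m v ≡ m₀ v) →
                   m (s (s w)) ≡ s (s w) → Step w

      step : ∀ {m} → State m ℓ → (∀ {v} → canon v ≢ c → m v ≡ m₀ v) →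
             ∀ {w} → canon w ≡ c → m w ≡ w → Step w
      step {m} st outside {w} w∈ mw = result
        where
        open State st
        u x : Fin n
        u = s w
        x = s u
        u∈ : canon u ≡ c
        u∈ = trans (canon-π w) w∈
        x∈ : canon x ≡ c
        x∈ = trans (canon-π u) u∈
        u≢w : u ≢ w
        u≢w = s≢ w∈
        x≢u : x ≢ u
        x≢u = s≢ u∈
        x≢w : x ≢ w
        x≢w = ss≢ w∈

        -- The alternatives in `along` are `u`, excluded because `w` is the only unmatched vertex of
        -- its orbit, and `w`, which is its own partner.
        mu≡x : m u ≡ x
        mu≡x with along u
        ... | inj₁ fix       = contradiction (oneFixed (trans u∈ (sym w∈)) fix mw) u≢w
        ... | inj₂ (inj₁ eq) = eq
        ... | inj₂ (inj₂ eq) = contradiction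
          (trans (sym (involutive u)) (trans (cong m (trans eq (s⁻¹-s w))) mw)) u≢w

        m° m′ : Fin n → Fin n
        m° = detach m u
        m′ = attach m° w u

        m°-inv : Involutive m°
        m°-inv = detach-involutive u involutive

        m°u : m° u ≡ u
        m°u = detach-fixed m u

        m°x : m° x ≡ x
        m°x = subst (λ y → m° y ≡ y) mu≡x (detach-fixed′ m u)

        m°-elsewhere : ∀ {v} → v ≢ u → v ≢ x → m° v ≡ m v
        m°-elsewhere v≢u v≢x = detach-elsewhere m v≢u (λ eq → v≢x (trans eq mu≡x))

        m°w : m° w ≡ w
        m°w = trans (m°-elsewhere (≢-sym u≢w) (≢-sym x≢w)) mw

        m′-inv : Involutive m′
        m′-inv = attach-involutive m°-inv m°w m°u

        m′x : m′ x ≡ x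
        m′x = trans (attach-elsewhere m° x≢w x≢u) m°x

        m′-elsewhere : ∀ {v} → canon v ≢ c → m′ v ≡ m v
        m′-elsewhere {v} v∉ = trans
          (attach-elsewhere m° {w} {u} {v} (λ { refl → v∉ w∈ }) (λ { refl → v∉ u∈ }))
          (m°-elsewhere {v} (λ { refl → v∉ u∈ }) (λ { refl → v∉ x∈ }))

        outside′ : ∀ {v} → canon v ≢ c → m′ v ≡ m₀ v
        outside′ v∉ = trans (m′-elsewhere v∉) (outside v∉)

        along′ : Along m′
        along′ = attach-elim (λ v y → y ≡ v ⊎ y ≡ s v ⊎ y ≡ s⁻¹ v) m°
          (inj₂ (inj₁ refl)) (inj₂ (inj₂ (sym (s⁻¹-s w))))
          λ v _ _ → detach-elim (λ v y → y ≡ v ⊎ y ≡ s v ⊎ y ≡ s⁻¹ v) m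
            (inj₁ refl) (inj₁ refl) (λ v _ _ → along v) v

        fixed-in-orbit : ∀ {v} → canon v ≡ c → m′ v ≡ v → v ≡ x
        fixed-in-orbit {v} v∈ fix = cases (v Fin.≟ w) (v Fin.≟ u) (v Fin.≟ x)
          where
          cases : Dec (v ≡ w) → Dec (v ≡ u) → Dec (v ≡ x) → v ≡ x
          cases (yes refl) _ _ = contradiction (trans (sym (attach-left m° w u)) fix) u≢w
          cases _ (yes refl) _ = contradiction (trans (sym fix) (attach-right m° w u)) u≢w
          cases _ _ (yes v≡x)  = v≡x
          cases (no v≢w) (no v≢u) (no v≢x) = contradiction
            (oneFixed (trans v∈ (sym w∈))
              (trans (sym (trans (attach-elsewhere m° v≢w v≢u) (m°-elsewhere v≢u v≢x))) fix) mw) v≢w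

        oneFixed′ : OneFixedPerOrbit m′
        oneFixed′ {a} {b} a~b fa fb with canon a Fin.≟ c
        ... | yes a∈ = trans (fixed-in-orbit a∈ fa) (sym (fixed-in-orbit (trans (sym a~b) a∈) fb))
        ... | no  a∉ = oneFixed a~b (trans (sym (m′-elsewhere a∉)) fa)
          (trans (sym (m′-elsewhere (a∉ ∘ trans a~b))) fb)

        -- With `u` and `x` both unmatched, each of them could only be the other end of the path
        -- that starts at `w`; so at most one of them lies on it.
        module T = TwoInvolutions id id m° p m°-inv p-inv
        open T.Trace m°w

        S : Fin n → Set
        S v = T.canon v ≡ T.canon w

        S? : Decidable₁ S
        S? v = T.canon v Fin.≟ T.canon w

        ℓ-m° : ∀ v → ℓ (m° v) ≡ ℓ v
        ℓ-m° = detach-elim (λ v y → ℓ y ≡ ℓ v) m refl refl (λ v _ _ → ℓ-m v)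

        ℓ-π^ : ∀ i v → ℓ (T.π^ i v) ≡ ℓ v
        ℓ-π^ zero    v = refl
        ℓ-π^ (suc i) v = trans (ℓ-m° _) (trans (ℓ-p _) (ℓ-π^ i v))

        -- Detaching only removes a pair of `m`, so the old labels are constant on the components of
        -- `m°` and `p` as well.
        ℓ-S : ∀ {v} → S v → ℓ v ≡ ℓ w
        ℓ-S sv with T.canon≡⇒orbit (sym sv)
        ... | i , _ , refl = ℓ-π^ i w

        state′ : ℓ u ≡ ℓ w → State m′ ℓ
        state′ ℓu≡ℓw = record
          { involutive = m′-inv ; along = along′ ; oneFixed = oneFixed′
          ; ℓ-m = attach-elim (λ v y → ℓ y ≡ ℓ v) m° ℓu≡ℓw (sym ℓu≡ℓw) (λ v _ _ → ℓ-m° v)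
          ; ℓ-p = ℓ-p
          }

        result : Step w
        result with S? u | S? x
        ... | yes Su | yes Sx = contradiction
          (endpoint-unique Sx m°x x≢w Su m°u u≢w) x≢u
        -- `u` has the label of its old partner `x`, hence that of `w`. The new pair therefore
        -- respects `ℓ`, and no bit is added.
        ... | no ¬Su | yes Sx = moved m′
          (state′ (trans (sym (trans (cong ℓ (sym mu≡x)) (ℓ-m u))) (ℓ-S Sx))) outside′ m′x
        -- Both `u` and `x` lie outside `S`, so `S` is closed under `m` itself and separates `w`
        -- from its successor `u`.
        ... | no ¬Su | no ¬Sx = resolved (split S? st outside
          (λ {v} Sv → subst S (m°-elsewhere (λ { refl → ¬Su Sv }) (λ { refl → ¬Sx Sv })) (f-closed Sv))
          g-closed
          λ v∈ fix → inj₁ (exposed v∈ fix))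
          where
          exposed : ∀ {v} → canon v ≡ c → m v ≡ v → S v × ¬ S (s v)
          exposed v∈ fix with oneFixed (trans v∈ (sym w∈)) fix mw
          ... | refl = refl , ¬Su
        -- `S` contains the new pair of `w` and `u`, so it is closed under `m′`. The vertex now
        -- unmatched is `x`, outside `S`, and its predecessor `u` is inside.
        ... | yes Su | no ¬Sx = resolved (split S? (state′ (ℓ-S Su)) outside′
          (λ {v} → attach-elim (λ v y → S v → S y) m° (λ _ → Su) (λ _ → refl) (λ v _ _ → f-closed) v)
          g-closed
          λ v∈ fix → inj₂ (exposed v∈ fix))
          where
          exposed : ∀ {v} → canon v ≡ c → m′ v ≡ v → ¬ S v × S (s⁻¹ v)
          exposed v∈ fix with fixed-in-orbit v∈ fix
          ... | refl = ¬Sx , subst S (sym (s⁻¹-s u)) Su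

      module _ {w₀ : Fin n} (w₀∈ : canon w₀ ≡ c) (m₀w₀ : m₀ w₀ ≡ w₀)
               (odd : parity (period w₀) ≡ 1ℙ) where

        private
          -- Depends on m₀ only outside the orbit, hence does not change under rotation.
          m~ : Fin n → Fin n
          m~ v with canon v Fin.≟ c
          ... | yes _ = v
          ... | no  _ = m₀ v

          m~-inside : ∀ {v} → canon v ≡ c → m~ v ≡ v
          m~-inside {v} v∈ with canon v Fin.≟ c
          ... | yes _  = refl
          ... | no  v∉ = contradiction v∈ v∉

          m~-outside : ∀ {v} → canon v ≢ c → m~ v ≡ m₀ v
          m~-outside {v} v∉ with canon v Fin.≟ c
          ... | yes v∈ = contradiction v∈ v∉
          ... | no  _  = refl

          m~-inv : Involutive m~
          m~-inv v = cases (canon v Fin.≟ c)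
            where
            cases : Dec (canon v ≡ c) → m~ (m~ v) ≡ v
            cases (yes v∈) = trans (cong m~ (m~-inside v∈)) (m~-inside v∈)
            cases (no v∉)  = trans (cong m~ (m~-outside v∉))
              (trans (m~-outside (v∉ ∘ trans (sym (along⇒canon (State.along st₀) v))))
                     (State.involutive st₀ v))

          module T = TwoInvolutions id id m~ p m~-inv p-inv

          vs : List (Fin n)
          vs = applyUpTo (λ i → π^ i w₀) (period w₀)

          ∈vs⇒ : ∀ {v} → v List.∈ vs → canon v ≡ c
          ∈vs⇒ v∈ with ∈-applyUpTo⁻ (λ i → π^ i w₀) v∈
          ... | i , _ , refl = trans (canon-π^ i w₀) w₀∈

          vs-unique : Unique vs
          vs-unique = applyUpTo⁺₁ _ _ λ i<j j<d eq →
            ℕ.<⇒≢ i<j (π^-injective-< (ℕ.<-trans i<j j<d) j<d eq)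

          -- All vertices of the orbit are fixed by `m~`, so `endpoint-unique` allows at most two of
          -- them in a component. As their number is odd, one is alone.
          free : ∃ λ f → f List.∈ vs × (∀ {v} → v List.∈ vs → T.canon v ≡ T.canon f → v ≡ f)
          free = loner Fin._≟_ T.canon vs vs-unique
            (trans (cong parity (length-applyUpTo (λ i → π^ i w₀) (period w₀))) odd)
            λ x∈ y∈ z∈ y~x z~x y≢x z≢x → T.Trace.endpoint-unique (m~-inside (∈vs⇒ x∈))
              y~x (m~-inside (∈vs⇒ y∈)) y≢x z~x (m~-inside (∈vs⇒ z∈)) z≢x

          f : Fin n
          f = proj₁ free

          f∈ : canon f ≡ c
          f∈ = ∈vs⇒ (proj₁ (proj₂ free))

          f-alone : ∀ {v} → canon v ≡ c → T.canon v ≡ T.canon f → v ≡ f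
          f-alone v∈ with canon≡⇒orbit (trans w₀∈ (sym v∈))
          ... | i , i<d , refl = proj₂ (proj₂ free) (∈-applyUpTo⁺ (λ i → π^ i w₀) i<d)

          -- An odd orbit is also an orbit of s ∘ s.
          hops : ∃ λ t → π^ (t + t) w₀ ≡ f
          hops with ∈-applyUpTo⁻ (λ i → π^ i w₀) (proj₁ (proj₂ free))
          ... | i , _ , f≡ with even⊎odd i
          ...   | inj₁ i-even = let t , 2t≡ = half i i-even in
            t , trans (cong (λ k → π^ k w₀) 2t≡) (sym f≡)
          ...   | inj₂ i-odd = let t , 2t≡ = half (i + period w₀) sum-even in
            t , trans (cong (λ k → π^ k w₀) 2t≡)
              (trans (π^-+ i (period w₀) w₀) (trans (cong (π^ i) (π^-period w₀)) (sym f≡)))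
            where
            sum-even : parity (i + period w₀) ≡ 0ℙ
            sum-even = trans (Parity.+-homo-+ i (period w₀)) (cong₂ Parity._+_ i-odd odd)

          -- Each move advances the unmatched vertex by two, so after `t` moves it is `f`. The
          -- component of `f` under `m~` and `p` is then closed under `m`: it meets the orbit in `f`
          -- only, which `m` fixes, and elsewhere `m` agrees with `m~`.
          run : ∀ t {m} → State m ℓ → (∀ {v} → canon v ≢ c → m v ≡ m₀ v) →
            ∀ {w} → canon w ≡ c → m w ≡ w → π^ (t + t) w ≡ f → Resolved c m₀ ℓ
          run zero {m} st outside w∈ mw refl =
            split (λ v → T.canon v Fin.≟ T.canon f) st outside closed (T.Trace.g-closed m~f)
              λ v∈ fix → inj₁ (exposed v∈ fix)
            where
            m~f : m~ f ≡ f
            m~f = m~-inside f∈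
            closed : ∀ {v} → T.canon v ≡ T.canon f → T.canon (m v) ≡ T.canon f
            closed {v} Sv = cases (canon v Fin.≟ c)
              where
              cases : Dec (canon v ≡ c) → T.canon (m v) ≡ T.canon f
              cases (yes v∈) = trans (cong (T.canon ∘ m) (f-alone v∈ Sv)) (cong T.canon mw)
              cases (no v∉)  = trans (cong T.canon (trans (outside v∉) (sym (m~-outside v∉))))
                                     (T.Trace.f-closed m~f Sv)
            exposed : ∀ {v} → canon v ≡ c → m v ≡ v → T.canon v ≡ T.canon f × T.canon (s v) ≢ T.canon f
            exposed v∈ fix with State.oneFixed st (trans v∈ (sym f∈)) fix mw
            ... | refl = refl , λ Ssf → s≢ f∈ (f-alone (trans (canon-π f) f∈) Ssf)
          run (suc t) st outside {w} w∈ mw eq with step st outside w∈ mw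
          ... | resolved r = r
          ... | moved m st′ outside′ fix = run t st′ outside′
            (trans (canon-π (s w)) (trans (canon-π w) w∈)) fix
            (trans (sym (trans (π^-suc (suc (t + t)) w) (π^-suc (t + t) (s w))))
                   (trans (cong (λ k → π^ (suc k) w) (sym (ℕ.+-suc t t))) eq))

        opaque
          resolve : Resolved c m₀ ℓ
          resolve = let t , eq = hops in run t st₀ (λ _ → refl) w₀∈ m₀w₀ eq

-- Treating the long odd orbits one after another

module _ {n : ℕ} (σ : Permutation′ n) (p : Fin n → Fin n) (p-inv : Involutive p) where

  open Successor σ
  open Rotation σ p p-inv

  module _ {Long : Fin n → Set} (long? : Decidable₁ Long)
    (3≤period : ∀ {v} → Long (canon v) → 3 ≤ period v)
    (odd : ∀ {v} → Long (canon v) → parity (period v) ≡ 1ℙ)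
    {m₀ : Fin n → Fin n} (m₀-inv : Involutive m₀) (along₀ : Along m₀) (one₀ : OneFixedPerOrbit m₀)
    where

    -- Orbits are treated in the order of their representatives. The field `short` keeps the initial
    -- matching on the other orbits, so that what `orbitMatching` says about unmatched vertices
    -- stays available there.
    record ResolvedBelow (j : ℕ) : Set where
      field
        m         : Fin n → Fin n
        k         : ℕ
        ℓ         : Fin n → Vec Bool k
        state     : State m ℓ
        short     : ∀ {v} → ¬ Long (canon v) → m v ≡ m₀ v
        separated : ∀ {v} → Long (canon v) → toℕ (canon v) < j → m v ≡ v → Separated ℓ v

    resolveBelow : ∀ j → j ≤ n → ResolvedBelow j
    resolveBelow zero _ = record
      { m = m₀ ; k = 0 ; ℓ = λ _ → []
      ; state = record { involutive = m₀-inv ; along = along₀ ; oneFixed = one₀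
                       ; ℓ-m = λ _ → refl ; ℓ-p = λ _ → refl }
      ; short = λ _ → refl ; separated = λ _ () }
    resolveBelow (suc j) j<n with resolveBelow j (ℕ.<⇒≤ j<n)
    ... | R = result
      where
      open ResolvedBelow R
      c : Fin n
      c = fromℕ< j<n

      lower : ∀ {v} → canon v ≢ c → toℕ (canon v) < suc j → toℕ (canon v) < j
      lower v∉ v<1+j = ℕ.≤∧≢⇒< (s≤s⁻¹ v<1+j)
        (λ eq → v∉ (Fin.toℕ-injective (trans eq (sym (Fin.toℕ-fromℕ< j<n)))))

      result : ResolvedBelow (suc j)
      result with long? c | Fin.any? (λ v → (canon v Fin.≟ c) ×-dec (m v Fin.≟ v))
      -- If `c` represents no orbit, this case or the next one applies.
      ... | no ¬long | _ = record
        { m = m ; k = k ; ℓ = ℓ ; state = state ; short = short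
        ; separated = λ long v<1+j → separated long
            (lower (λ eq → ¬long (subst Long eq long)) v<1+j) }
      ... | yes _ | no ¬any = record
        { m = m ; k = k ; ℓ = ℓ ; state = state ; short = short
        ; separated = λ long v<1+j fix → separated long
            (lower (λ eq → ¬any (_ , eq , fix)) v<1+j) fix }
      ... | yes long | yes (w , w∈ , mw) = record
        { m = R′.m ; k = R′.k ; ℓ = R′.ℓ ; state = R′.state
        ; short = λ ¬long → trans (R′.outside (λ eq → ¬long (subst Long (sym eq) long))) (short ¬long)
        ; separated = separated′ }
        where
        module R′ = Resolved (resolve {ℓ = ℓ} state
          (λ v∈ → 3≤period (subst Long (sym v∈) long)) w∈ mw (odd (subst Long (sym w∈) long)))
        separated′ : ∀ {v} → Long (canon v) → toℕ (canon v) < suc j → R′.m v ≡ v → Separated R′.ℓ v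
        separated′ {v} long′ v<1+j fix with canon v Fin.≟ c
        ... | yes v∈ = R′.separated v∈ fix
        ... | no  v∉ = Sum.map R′.refines R′.refines
          (separated long′ (lower v∉ v<1+j) (trans (sym (R′.outside v∉)) fix))

-- Max-cut

count : {A : Set} → (A → Bool) → List A → ℕ
count f xs = length (filterᵇ f xs)

count-cong : ∀ {A : Set} {f g : A → Bool} xs →
  (∀ {x} → x List.∈ xs → f x ≡ g x) → count f xs ≡ count g xs
count-cong [] _ = refl
count-cong {f = f} {g} (x ∷ xs) f≡g with f x | g x | f≡g (here refl)
... | true  | true  | _ = cong suc (count-cong xs (f≡g ∘ there))
... | false | false | _ = count-cong xs (f≡g ∘ there)

count-partition : ∀ {A : Set} (q f : A → Bool) xs →
  count f xs ≡ count f (filterᵇ q xs) + count f (filterᵇ (not ∘ q) xs)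
count-partition q f [] = refl
count-partition q f (x ∷ xs) with q x
... | true with f x
...   | true  = cong suc (count-partition q f xs)
...   | false = count-partition q f xs
count-partition q f (x ∷ xs) | false with f x
...   | true  = trans (cong suc (count-partition q f xs)) (sym (ℕ.+-suc _ _))
...   | false = count-partition q f xs

length-partition : ∀ {A : Set} (q : A → Bool) xs →
  length xs ≡ length (filterᵇ q xs) + length (filterᵇ (not ∘ q) xs)
length-partition q [] = refl
length-partition q (x ∷ xs) with q x
... | true  = cong suc (length-partition q xs)
... | false = trans (cong suc (length-partition q xs)) (sym (ℕ.+-suc _ _))

∈-filterᵇ⁻ : ∀ {A : Set} (q : A → Bool) {x} xs → x List.∈ filterᵇ q xs → x List.∈ xs × q x ≡ true
∈-filterᵇ⁻ q (y ∷ ys) x∈ with q y in eq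
∈-filterᵇ⁻ q (y ∷ ys) (here refl) | true  = here refl , eq
∈-filterᵇ⁻ q (y ∷ ys) (there x∈)  | true  = let x∈ys , qx = ∈-filterᵇ⁻ q ys x∈ in there x∈ys , qx
∈-filterᵇ⁻ q (y ∷ ys) x∈          | false = let x∈ys , qx = ∈-filterᵇ⁻ q ys x∈ in there x∈ys , qx

∈-filterᵇ⁺ : ∀ {A : Set} (q : A → Bool) {x xs} → x List.∈ xs → q x ≡ true → x List.∈ filterᵇ q xs
∈-filterᵇ⁺ q (here {x = y} refl) qx rewrite qx = here refl
∈-filterᵇ⁺ q (there {x = y} x∈) qx with q y
... | true  = there (∈-filterᵇ⁺ q x∈ qx)
... | false = ∈-filterᵇ⁺ q x∈ qx

-- Every element is counted for exactly one value of `s`, so one of the two counts is at most half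
-- the length.
flipHalf : ∀ {A : Set} (d : A → Bool) xs →
  ∃ λ s → 2 * count (λ x → d x xor s) xs ≤ length xs
flipHalf d xs = cases (2 * count (λ x → d x xor false) xs ℕ.≤? length xs)
  where
  total : ∀ xs → count (λ x → d x xor false) xs + count (λ x → d x xor true) xs ≡ length xs
  total [] = refl
  total (x ∷ xs) with d x
  ... | true  = cong suc (total xs)
  ... | false = trans (ℕ.+-suc _ _) (cong suc (total xs))
  cases : Dec (2 * count (λ x → d x xor false) xs ≤ length xs) →
          ∃ λ s → 2 * count (λ x → d x xor s) xs ≤ length xs
  cases (yes ≤half) = false , ≤half
  cases (no  >half) = true , ℕ.+-cancelˡ-≤ (2 * a) _ _ (begin
    2 * a + 2 * b        ≡⟨ ℕ.*-distribˡ-+ 2 a b ⟨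
    2 * (a + b)          ≡⟨ cong (2 *_) (total xs) ⟩
    2 * length xs        ≡⟨ cong (length xs +_) (ℕ.+-identityʳ _) ⟩
    length xs + length xs ≤⟨ ℕ.+-monoˡ-≤ _ (ℕ.≰⇒≥ >half) ⟩
    2 * a + length xs    ∎)
    where
    open ℕ.≤-Reasoning
    a = count (λ x → d x xor false) xs
    b = count (λ x → d x xor true) xs

xor-interchange : ∀ a b c d → (a xor b) xor (c xor d) ≡ (a xor c) xor (b xor d)
xor-interchange = CommutativeSemigroup.interchange
  (CommutativeRing.+-commutativeSemigroup Bool.xor-∧-commutativeRing)

-- Read as affine forms over 𝔽₂ in the values of g, the summands are not constant because
-- a x ≢ b x; g is found by treating the coordinates of Vec Bool k one at a time.
maxCut : ∀ k {A : Set} (a b : A → Vec Bool k) (d : A → Bool) (xs : List A) →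
  (∀ {x} → x List.∈ xs → a x ≢ b x) →
  ∃ λ (g : Vec Bool k → Bool) → 2 * count (λ x → d x xor (g (a x) xor g (b x))) xs ≤ length xs
maxCut zero    a b d []       _   = (λ _ → false) , z≤n
maxCut zero    a b d (x ∷ xs) a≢b with a x | b x | a≢b (here refl)
... | [] | [] | []≢[] = contradiction refl []≢[]
maxCut (suc k) {A} a b d xs a≢b = g , bound
  where
  agree : A → Bool
  agree x = does (Vec.≡-dec Bool._≟_ (tail (a x)) (tail (b x)))

  -- On `E` the two labels differ in the first bit only, so `s` alone decides the value there. On
  -- `T` the contribution of the first bit is absorbed into `d`, and the later bits are left to the
  -- recursion.
  E T : List A
  E = filterᵇ agree xs
  T = filterᵇ (not ∘ agree) xs

  E-tails : ∀ {x} → x List.∈ E → tail (a x) ≡ tail (b x)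
  E-tails {x} x∈ with Vec.≡-dec Bool._≟_ (tail (a x)) (tail (b x)) | proj₂ (∈-filterᵇ⁻ agree xs x∈)
  ... | yes eq | _ = eq

  T-tails : ∀ {x} → x List.∈ T → tail (a x) ≢ tail (b x)
  T-tails {x} x∈ with Vec.≡-dec Bool._≟_ (tail (a x)) (tail (b x)) | proj₂ (∈-filterᵇ⁻ (not ∘ agree) xs x∈)
  ... | no neq | _ = neq

  s : Bool
  s = proj₁ (flipHalf d E)

  sa sb : A → Bool
  sa x = s ∧ head (a x)
  sb x = s ∧ head (b x)

  IH : ∃ λ (g : Vec Bool k → Bool) →
    2 * count (λ x → (d x xor (sa x xor sb x)) xor (g (tail (a x)) xor g (tail (b x)))) T ≤ length T
  IH = maxCut k (tail ∘ a) (tail ∘ b) (λ x → d x xor (sa x xor sb x)) T T-tails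

  g′ : Vec Bool k → Bool
  g′ = proj₁ IH

  g : Vec Bool (suc k) → Bool
  g (h ∷ t) = (s ∧ h) xor g′ t

  g-split : ∀ v → g v ≡ (s ∧ head v) xor g′ (tail v)
  g-split (h ∷ t) = refl

  value : A → Bool
  value x = d x xor (g (a x) xor g (b x))

  value-split : ∀ x → value x ≡ (d x xor (sa x xor sb x)) xor (g′ (tail (a x)) xor g′ (tail (b x)))
  value-split x = trans (cong (d x xor_)
      (trans (cong₂ _xor_ (g-split (a x)) (g-split (b x))) (xor-interchange (sa x) _ (sb x) _)))
    (sym (Bool.xor-assoc (d x) _ _))

  heads-differ : ∀ {x} → x List.∈ E → sa x xor sb x ≡ s
  heads-differ {x} x∈ with a x | b x | E-tails x∈ | a≢b (proj₁ (∈-filterᵇ⁻ agree xs x∈))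
  ... | i ∷ _     | j ∷ _     | refl | a≢b = lemma s i j λ { refl → a≢b refl }
    where
    lemma : ∀ s i j → i ≢ j → (s ∧ i) xor (s ∧ j) ≡ s
    lemma false i     j     _   = refl
    lemma true  false false i≢j = contradiction refl i≢j
    lemma true  false true  _   = refl
    lemma true  true  false _   = refl
    lemma true  true  true  i≢j = contradiction refl i≢j

  value-E : ∀ {x} → x List.∈ E → value x ≡ d x xor s
  value-E {x} x∈ = begin
    value x                                              ≡⟨ value-split x ⟩
    (d x xor (sa x xor sb x)) xor (g′ (tail (a x)) xor g′ (tail (b x)))
      ≡⟨ cong₂ (λ y z → (d x xor y) xor (g′ (tail (a x)) xor g′ z)) (heads-differ x∈) (sym (E-tails x∈)) ⟩
    (d x xor s) xor (g′ (tail (a x)) xor g′ (tail (a x)))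
      ≡⟨ cong ((d x xor s) xor_) (Bool.xor-same (g′ (tail (a x)))) ⟩
    (d x xor s) xor false                                ≡⟨ Bool.xor-identityʳ _ ⟩
    d x xor s                                            ∎
    where open ≡-Reasoning

  bound : 2 * count value xs ≤ length xs
  bound = begin
    2 * count value xs                     ≡⟨ cong (2 *_) (count-partition agree value xs) ⟩
    2 * (count value E + count value T)    ≡⟨ ℕ.*-distribˡ-+ 2 (count value E) _ ⟩
    2 * count value E + 2 * count value T
      ≡⟨ cong₂ (λ i j → 2 * i + 2 * j) (count-cong E value-E) (count-cong T (λ {x} _ → value-split x)) ⟩
    2 * count (λ x → d x xor s) E
      + 2 * count (λ x → (d x xor (sa x xor sb x)) xor (g′ (tail (a x)) xor g′ (tail (b x)))) T
      ≤⟨ ℕ.+-mono-≤ (proj₂ (flipHalf d E)) (proj₂ IH) ⟩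
    length E + length T                    ≡⟨ length-partition agree xs ⟨
    length xs                              ∎
    where open ℕ.≤-Reasoning

-- Quadruples and their pairings

swap₄ : Fin 4 → Fin 4
swap₄ zero                   = suc zero
swap₄ (suc zero)             = zero
swap₄ (suc (suc zero))       = suc (suc (suc zero))
swap₄ (suc (suc (suc zero))) = suc (suc zero)

swap₄-involutive : Involutive swap₄
swap₄-involutive = from-yes (Fin.all? λ i → swap₄ (swap₄ i) Fin.≟ i)

swap₄-free : ∀ i → i ≢ swap₄ i
swap₄-free = from-yes (Fin.all? λ i → ¬? (i Fin.≟ swap₄ i))

-- If both pairs of a quadruple are bichromatic, a vertex `i` shares its side with only one other:
-- candidates `j` and `k` both lie in the pair not containing `i`, and that pair has one vertex on
-- each side.
same-pair : ∀ i j k → j ≢ i → k ≢ i → j ≢ swap₄ i → k ≢ swap₄ i → j ≢ swap₄ k → j ≡ k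
same-pair = from-yes (Fin.all? λ i → Fin.all? λ j → Fin.all? λ k →
  ¬? (j Fin.≟ i) →-dec (¬? (k Fin.≟ i) →-dec (¬? (j Fin.≟ swap₄ i) →-dec
  (¬? (k Fin.≟ swap₄ i) →-dec (¬? (j Fin.≟ swap₄ k) →-dec (j Fin.≟ k))))))

module Quadruples {n q : ℕ} (Y : Fin q → Subset n) (∣Y∣≡4 : ∀ j → ∣ Y j ∣ ≡ 4)
                  (disjoint : PairwiseDisjoint Y) where

  private
    list : ∀ j → ∃ λ (f : Fin 4 → Fin n) →
      Injective _≡_ _≡_ f × (∀ i → f i ∈ Y j) × (∀ {v} → v ∈ Y j → ∃ λ i → f i ≡ v)
    list j = subst (λ k → ∃ λ (f : Fin k → Fin n) →
      Injective _≡_ _≡_ f × (∀ i → f i ∈ Y j) × (∀ {v} → v ∈ Y j → ∃ λ i → f i ≡ v))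
      (∣Y∣≡4 j) (enumerate (Y j))

    y : ∀ j → Fin 4 → Fin n
    y j = proj₁ (list j)

    y-injective : ∀ j → Injective _≡_ _≡_ (y j)
    y-injective j = proj₁ (proj₂ (list j))

    y∈ : ∀ j i → y j i ∈ Y j
    y∈ j = proj₁ (proj₂ (proj₂ (list j)))

    y-onto : ∀ j {v} → v ∈ Y j → ∃ λ i → y j i ≡ v
    y-onto j = proj₂ (proj₂ (proj₂ (list j)))

    same-index : ∀ {j j′ v} → v ∈ Y j → v ∈ Y j′ → j ≡ j′
    same-index {j} {j′} {v} v∈ v∈′ with j Fin.≟ j′
    ... | yes eq = eq
    ... | no neq = contradiction (v , x∈p∩q⁺ (v∈ , v∈′)) (disjoint j j′ neq)

    ys-unique : ∀ {j j′ i i′} → y j i ≡ y j′ i′ → y j (swap₄ i) ≡ y j′ (swap₄ i′)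
    ys-unique {j} {j′} {i} {i′} eq with same-index (y∈ j i) (subst (_∈ Y j′) (sym eq) (y∈ j′ i′))
    ... | refl = cong (y j ∘ swap₄) (y-injective j eq)

  Paired : Fin n → Fin n → Set
  Paired u v = ∃₂ λ j i → y j i ≡ u × y j (swap₄ i) ≡ v

  paired : Matching Paired
  paired = record
    { symmetric   = λ { (j , i , eq , eq′) →
        j , swap₄ i , eq′ , trans (cong (y j) (swap₄-involutive i)) eq }
    ; irreflexive = λ { refl (j , i , eq , eq′) → swap₄-free i (y-injective j (trans eq (sym eq′))) }
    ; unique      = λ { (j , i , eq₁ , eq₂) (j′ , i′ , eq₃ , eq₄) →
        trans (sym eq₂) (trans (ys-unique (trans eq₁ (sym eq₃))) eq₄) }
    ; partner?    = λ u → Fin.any? λ v → Fin.any? λ j → Fin.any? λ i →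
        (y j i Fin.≟ u) ×-dec (y j (swap₄ i) Fin.≟ v)
    }

  module _ (c : Fin n → Bool) (proper : ∀ {u v} → Paired u v → c u ≢ c v) where

    SameSide : Fin n → Fin n → Set
    SameSide u v = (u ≢ v × ∃ λ j → u ∈ Y j × v ∈ Y j) × c u ≡ c v

    sameSide : Matching SameSide
    sameSide = record
      { symmetric   = λ { ((u≢v , j , u∈ , v∈) , eq) → (≢-sym u≢v , j , v∈ , u∈) , sym eq }
      ; irreflexive = λ { u≡v ((u≢v , _) , _) → u≢v u≡v }
      ; unique      = unique
      ; partner?    = λ u → Fin.any? λ v →
          ((¬? (u Fin.≟ v)) ×-dec Fin.any? λ j → (u ∈? Y j) ×-dec (v ∈? Y j)) ×-dec (c u Bool.≟ c v)
      }
      where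
      ≢swap : ∀ {j i i′} → c (y j i) ≡ c (y j i′) → i′ ≢ swap₄ i
      ≢swap {j} {i} eq refl = proper (j , i , refl , refl) eq
      unique : ∀ {u v w} → SameSide u v → SameSide u w → v ≡ w
      unique ((u≢v , j , u∈ , v∈) , cuv) ((u≢w , j′ , u∈′ , w∈) , cuw)
        with same-index u∈ u∈′
      ... | refl with y-onto j u∈ | y-onto j v∈ | y-onto j w∈
      ... | i , refl | i′ , refl | i″ , refl = cong (y j)
        (same-pair i i′ i″ (λ { refl → u≢v refl }) (λ { refl → u≢w refl })
          (≢swap cuv) (≢swap cuw) (≢swap (trans (sym cuw) cuv)))

-- Long odd cycles as orbits

listing⇒IsCycle : ∀ {n} (H : Graph (Fin n)) (S : Subset n) → 3 ≤ ∣ S ∣ →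
  (γ : Fin ∣ S ∣ → Fin n) → Injective _≡_ _≡_ γ →
  (∀ {v} → v ∈ S → ∃ λ i → γ i ≡ v) → (∀ i → γ i ∈ S) →
  (∀ {i j} → Adj H (γ i) (γ j) → Next i j ⊎ Next j i) →
  (∀ {i j} → Next i j → Adj H (γ i) (γ j)) → IsCycle H S
listing⇒IsCycle H S 3≤ γ inj onto into adj⇒ next⇒ = 3≤ , tabulate γ ,
  (λ i j eq → inj (trans (sym (γ≡ i)) (trans eq (γ≡ j)))) ,
  (λ v → mk⇔ (λ v∈ → let i , eq = onto v∈ in i , trans (γ≡ i) eq)
             (λ (i , eq) → subst (_∈ S) (trans (sym (γ≡ i)) eq) (into i))) ,
  (λ i j → mk⇔ (λ adj → adj⇒ (subst₂ (Adj H) (γ≡ i) (γ≡ j) adj))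
               (λ nx → subst₂ (Adj H) (sym (γ≡ i)) (sym (γ≡ j))
                          ([ next⇒ , symm H ∘ next⇒ ] nx)))
  where
  γ≡ : ∀ i → lookup (tabulate γ) i ≡ γ i
  γ≡ = lookup∘tabulate γ

short-odd : ∀ k → parity k ≡ 1ℙ → ¬ 5 ≤ k → k ≡ 1 ⊎ k ≡ 3
short-odd 1 _ _ = inj₁ refl
short-odd 3 _ _ = inj₂ refl
short-odd (suc (suc (suc (suc (suc k))))) _ ≱5 = contradiction (ℕ.m≤m+n 5 k) ≱5

module Cycles {n : ℕ} (H : Graph (Fin n)) (σ : Permutation′ n)
  (covers : ∀ {u v} → Adj H u v → v ≡ Successor.s σ u ⊎ v ≡ Successor.s⁻¹ σ u) where

  open Successor σ

  Edge : Fin n → Set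
  Edge v = Adj H v (s v)

  edge? : Decidable₁ Edge
  edge? v = adj? H v (s v)

  -- A property of orbits, expressed through the representative `c`. For odd lengths, being greater
  -- than 3 means being at least 5.
  Long : Fin n → Set
  Long c = (∀ v → canon v ≡ c → Edge v) × parity (period c) ≡ 1ℙ × 5 ≤ period c

  long? : Decidable₁ Long
  long? c = Fin.all? (λ v → (canon v Fin.≟ c) →-dec edge? v)
    ×-dec (parity (period c) Parity.≟ 1ℙ) ×-dec (5 ≤? period c)

  adj-canon : ∀ {u v} → Adj H u v → canon v ≡ canon u
  adj-canon {u} uv with covers uv
  ... | inj₁ eq = trans (cong canon eq) (canon-π u)
  ... | inj₂ eq = trans (cong canon eq) (canon-s⁻¹ u)

  -- Edges follow `s` or its inverse, so a component of `H` stays inside one orbit.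
  walk-canon : ∀ {u v} → Star (Adj H) u v → canon v ≡ canon u
  walk-canon ε        = refl
  walk-canon (e ◅ es) = trans (walk-canon es) (adj-canon e)

  orbit : Fin n → Subset n
  orbit c = comprehension (λ v → canon v Fin.≟ c)

  ∈-orbit⁺ : ∀ {v c} → canon v ≡ c → v ∈ orbit c
  ∈-orbit⁺ {c = c} = ∈-comprehension⁺ (λ v → canon v Fin.≟ c)

  ∈-orbit⁻ : ∀ {v c} → v ∈ orbit c → canon v ≡ c
  ∈-orbit⁻ {c = c} = ∈-comprehension⁻ (λ v → canon v Fin.≟ c)

  module _ {c : Fin n} (canon-c : canon c ≡ c) where

    γ : ℕ → Fin n
    γ i = π^ i c

    γ∈ : ∀ i → γ i ∈ orbit c
    γ∈ i = ∈-orbit⁺ (trans (canon-π^ i c) canon-c)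

    position : ∀ {v} → v ∈ orbit c → ∃ λ i → i < period c × γ i ≡ v
    position v∈ = canon≡⇒orbit (trans canon-c (sym (∈-orbit⁻ v∈)))

    ∣orbit∣ : ∣ orbit c ∣ ≡ period c
    ∣orbit∣ = ℕ.≤-antisym
      (∣S∣≤ (orbit c) {g = id} (λ v∈ → fromℕ< (proj₁ (proj₂ (position v∈)))) id
        λ u∈ v∈ eq → trans (sym (proj₂ (proj₂ (position u∈)))) (trans
          (cong γ (trans (sym (Fin.toℕ-fromℕ< _)) (trans (cong toℕ eq) (Fin.toℕ-fromℕ< _))))
          (proj₂ (proj₂ (position v∈)))))
      (injective⇒≤∣S∣ (orbit c) {f = γ ∘ toℕ}
        (λ {i} {j} eq → Fin.toℕ-injective (π^-injective-< (Fin.toℕ<n i) (Fin.toℕ<n j) eq))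
        (γ∈ ∘ toℕ))

    orbit-cycle : Long c → IsLongOddCycle H (orbit c)
    orbit-cycle (edges , odd , 5≤) = (component , cycle) ,
      subst (λ k → k % 2 ≡ 1) (sym ∣orbit∣) (odd⇒%2≡1 (period c) odd) ,
      subst (4 ≤_) (sym ∣orbit∣) (ℕ.≤-trans (ℕ.n≤1+n 4) 5≤)
      where
      <period : (i : Fin ∣ orbit c ∣) → toℕ i < period c
      <period i = subst (toℕ i <_) ∣orbit∣ (Fin.toℕ<n i)

      edge : ∀ i → Adj H (γ i) (γ (suc i))
      edge i = edges (γ i) (∈-orbit⁻ (γ∈ i))

      walk : ∀ {u} → canon u ≡ c → ∀ i → Star (Adj H) u (π^ i u)
      walk u∈ zero    = ε
      walk u∈ (suc i) = walk u∈ i ◅◅ edges _ (trans (canon-π^ i _) u∈) ◅ ε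

      component : IsComponent H (orbit c)
      component = (c , ∈-orbit⁺ canon-c) , λ u u∈ v → mk⇔
        (λ v∈ → reach (∈-orbit⁻ u∈) (∈-orbit⁻ v∈))
        (λ uv → ∈-orbit⁺ (trans (walk-canon uv) (∈-orbit⁻ u∈)))
        where
        reach : ∀ {u v} → canon u ≡ c → canon v ≡ c → Star (Adj H) u v
        reach u∈ v∈ with canon≡⇒orbit (trans u∈ (sym v∈))
        ... | i , _ , refl = walk u∈ i

      next : (i j : Fin ∣ orbit c ∣) → γ (toℕ j) ≡ s (γ (toℕ i)) → Next i j
      next i j eq with ℕ.m≤n⇒m<n∨m≡n (<period i)
      ... | inj₁ 1+i<d = inj₁ (π^-injective-< (<period j) 1+i<d eq)
      ... | inj₂ 1+i≡d = inj₂ (trans 1+i≡d (sym ∣orbit∣) ,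
        π^-injective-< (<period j) (period>0 c)
          (trans eq (trans (cong γ 1+i≡d) (π^-period c))))

      next⇒adj : {i j : Fin ∣ orbit c ∣} → Next i j → Adj H (γ (toℕ i)) (γ (toℕ j))
      next⇒adj {i} {j} (inj₁ j≡1+i) = subst (λ k → Adj H (γ (toℕ i)) (γ k)) (sym j≡1+i) (edge (toℕ i))
      next⇒adj {i} {j} (inj₂ (1+i≡ , j≡0)) = subst (Adj H (γ (toℕ i)))
        (trans (cong γ (trans 1+i≡ ∣orbit∣)) (trans (π^-period c) (cong γ (sym j≡0)))) (edge (toℕ i))

      cycle : IsCycle H (orbit c)
      cycle = listing⇒IsCycle H (orbit c)
        (subst (3 ≤_) (sym ∣orbit∣) (ℕ.≤-trans (ℕ.m≤m+n 3 2) 5≤))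
        (γ ∘ toℕ)
        (λ {i} {j} eq → Fin.toℕ-injective (π^-injective-< (<period i) (<period j) eq))
        (λ v∈ → let i , i<d , eq = position v∈ ; i<k = subst (i <_) (sym ∣orbit∣) i<d in
           fromℕ< i<k , trans (cong γ (Fin.toℕ-fromℕ< i<k)) eq)
        (γ∈ ∘ toℕ)
        (λ {i} {j} adj → Sum.map (next i j)
          (λ eq → next j i (trans (sym (s-s⁻¹ _)) (cong s (sym eq)))) (covers adj))
        next⇒adj

-- The deleted set and the four-colouring

module Deletion {n q : ℕ} (H : Graph (Fin n)) (Δ≤2 : Δ H ≤ 2) (Y : Fin q → Subset n)
                (∣Y∣≡4 : ∀ j → ∣ Y j ∣ ≡ 4) (disjoint : PairwiseDisjoint Y) where

  open Quadruples Y ∣Y∣≡4 disjoint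

  opaque
    successor : ∃ λ (σ : Permutation′ n) → ∀ {u v} → Adj H u v →
      v ≡ Successor.s σ u ⊎ v ≡ Successor.s⁻¹ σ u
    successor = cyclicSuccessor H Δ≤2

  σ : Permutation′ n
  σ = proj₁ successor

  open Successor σ

  covers : ∀ {u v} → Adj H u v → v ≡ s u ⊎ v ≡ s⁻¹ u
  covers = proj₂ successor

  open Cycles H σ covers

  p : Fin n → Fin n
  p = Matching.mate paired

  p-inv : Involutive p
  p-inv = Matching.mate-involutive paired

  open Rotation σ p p-inv using (Separated; module State)

  opaque
    initial : ∃ λ m → Involutive m × Along m × OneFixedPerOrbit m ×
      (∀ {v} → m v ≡ v → parity (period v) ≡ 1ℙ × (∀ {y} → canon y ≡ canon v → ¬ Edge y → ¬ Edge v))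
    initial = orbitMatching edge?

  m₀ : Fin n → Fin n
  m₀ = proj₁ initial

  m₀-involutive : Involutive m₀
  m₀-involutive = proj₁ (proj₂ initial)

  m₀-along : Along m₀
  m₀-along = proj₁ (proj₂ (proj₂ initial))

  m₀-oneFixed : OneFixedPerOrbit m₀
  m₀-oneFixed = proj₁ (proj₂ (proj₂ (proj₂ initial)))

  m₀-fixed : ∀ {v} → m₀ v ≡ v →
    parity (period v) ≡ 1ℙ × (∀ {y} → canon y ≡ canon v → ¬ Edge y → ¬ Edge v)
  m₀-fixed = proj₂ (proj₂ (proj₂ (proj₂ initial)))

  period-canon : ∀ v → period (canon v) ≡ period v
  period-canon v = period-cong (canon-canon v)

  long⇒3≤period : ∀ {v} → Long (canon v) → 3 ≤ period v
  long⇒3≤period {v} (_ , _ , 5≤) = subst (3 ≤_) (period-canon v) (ℕ.≤-trans (ℕ.m≤m+n 3 2) 5≤)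

  long⇒odd : ∀ {v} → Long (canon v) → parity (period v) ≡ 1ℙ
  long⇒odd {v} (_ , odd , _) = trans (cong parity (sym (period-canon v))) odd

  opaque
    everyOrbit : ResolvedBelow σ p p-inv long? long⇒3≤period long⇒odd
      m₀-involutive m₀-along m₀-oneFixed n
    everyOrbit = resolveBelow σ p p-inv long? long⇒3≤period long⇒odd
      m₀-involutive m₀-along m₀-oneFixed n ℕ.≤-refl

  open ResolvedBelow everyOrbit
  open State state

  opaque
    sides : ∃ λ (c : Fin n → Bool) →
      (∀ v → m v ≢ v → c (m v) ≢ c v) × (∀ v → p v ≢ v → c (p v) ≢ c v)
    sides = involutionColouring id id involutive p-inv

  c₀ : Fin n → Bool
  c₀ = proj₁ sides

  Exposed : Fin n → Set
  Exposed v = Long (canon v) × m v ≡ v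

  exposed? : Decidable₁ Exposed
  exposed? v = long? (canon v) ×-dec (m v Fin.≟ v)

  D : Subset n
  D = comprehension exposed?

  opaque
    exposedList : ∃ λ (f : Fin ∣ D ∣ → Fin n) → Injective _≡_ _≡_ f ×
      (∀ i → Exposed (f i)) × (∀ {v} → Exposed v → ∃ λ i → f i ≡ v)
    exposedList with enumerate D
    ... | f , inj , into , onto =
      f , inj , ∈-comprehension⁻ exposed? ∘ into , onto ∘ ∈-comprehension⁺ exposed?

  w : Fin ∣ D ∣ → Fin n
  w = proj₁ exposedList

  w-injective : Injective _≡_ _≡_ w
  w-injective = proj₁ (proj₂ exposedList)

  w-exposed : ∀ i → Exposed (w i)
  w-exposed = proj₁ (proj₂ (proj₂ exposedList))

  w-canon-injective : ∀ {i j} → canon (w i) ≡ canon (w j) → i ≡ j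
  w-canon-injective {i} {j} eq = w-injective
    (oneFixed eq (proj₂ (w-exposed i)) (proj₂ (w-exposed j)))

  opaque
    separatedNeighbour : ∀ i → ∃ λ u → (u ≡ s (w i) ⊎ u ≡ s⁻¹ (w i)) × ℓ (w i) ≢ ℓ u
    separatedNeighbour i with separated (proj₁ (w-exposed i)) (Fin.toℕ<n _) (proj₂ (w-exposed i))
    ... | inj₁ ℓ≢ = _ , inj₁ refl , ℓ≢
    ... | inj₂ ℓ≢ = _ , inj₂ refl , ℓ≢

  neighbour : Fin ∣ D ∣ → Fin n
  neighbour i = proj₁ (separatedNeighbour i)

  -- True when `w i` and its chosen neighbour end on the same side: the first term says that they
  -- agree under `c₀`, the second that exactly one of them is exchanged by `g`.
  uncut : (Vec Bool k → Bool) → Fin ∣ D ∣ → Bool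
  uncut g i = not (c₀ (w i) xor c₀ (neighbour i)) xor (g (ℓ (w i)) xor g (ℓ (neighbour i)))

  opaque
    cut : ∃ λ g → 2 * count (uncut g) (allFin ∣ D ∣) ≤ length (allFin ∣ D ∣)
    cut = maxCut k (ℓ ∘ w) (ℓ ∘ neighbour) (λ i → not (c₀ (w i) xor c₀ (neighbour i)))
      (allFin ∣ D ∣) (λ {i} _ → proj₂ (proj₂ (separatedNeighbour i)))

  g : Vec Bool k → Bool
  g = proj₁ cut

  c : Fin n → Bool
  c v = c₀ v xor g (ℓ v)

  -- With equal labels either both vertices change sides or neither does.
  c-flip : ∀ {u v} → ℓ u ≡ ℓ v → c₀ u ≢ c₀ v → c u ≢ c v
  c-flip {u} {v} ℓ≡ c₀≢ c≡ = c₀≢ (xor-cancelʳ (g (ℓ v)) (trans (cong (λ z → c₀ u xor g z) (sym ℓ≡)) c≡))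
    where
    xor-cancelʳ : ∀ z {x y} → x xor z ≡ y xor z → x ≡ y
    xor-cancelʳ z {false} {false} _  = refl
    xor-cancelʳ z {true}  {true}  _  = refl
    xor-cancelʳ z {false} {true}  eq = contradiction eq (Bool.not-¬ refl)
    xor-cancelʳ z {true}  {false} eq = contradiction (sym eq) (Bool.not-¬ refl)

  c-m : ∀ v → m v ≢ v → c (m v) ≢ c v
  c-m v mv≢v = c-flip (ℓ-m v) (proj₁ (proj₂ sides) v mv≢v)

  c-paired : ∀ {u v} → Paired u v → c u ≢ c v
  c-paired {u} {v} uv c≡ = c-flip (ℓ-p u)
    (proj₂ (proj₂ sides) u (λ pu≡u → Matching.irreflexive paired (sym (trans (sym pu≡v) pu≡u)) uv))
    (trans (cong c pu≡v) (sym c≡))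
    where
    pu≡v : p u ≡ v
    pu≡v = Matching.mate-R paired uv

  Bad : Fin n → Set
  Bad v = Exposed v × c v ≡ c (s v) × c v ≡ c (s⁻¹ v)

  bad? : Decidable₁ Bad
  bad? v = exposed? v ×-dec (c v Bool.≟ c (s v)) ×-dec (c v Bool.≟ c (s⁻¹ v))

  opaque
    Z : Subset n
    Z = comprehension bad?

    ∈Z⁺ : ∀ {v} → Bad v → v ∈ Z
    ∈Z⁺ = ∈-comprehension⁺ bad?

    ∈Z⁻ : ∀ {v} → v ∈ Z → Bad v
    ∈Z⁻ = ∈-comprehension⁻ bad?

  2∣Z∣≤∣D∣ : 2 * ∣ Z ∣ ≤ ∣ D ∣
  2∣Z∣≤∣D∣ = ℕ.≤-trans (ℕ.*-monoʳ-≤ 2 ∣Z∣≤) (ℕ.≤-trans (proj₂ cut) (ℕ.≤-reflexive (length-tabulate id)))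
    where
    uncut-true : ∀ i → c (w i) ≡ c (neighbour i) → uncut g i ≡ true
    uncut-true i c≡ = trans (rearrange (c₀ (w i)) _ _ _)
      (cong not (trans (cong (c (w i) xor_) (sym c≡)) (Bool.xor-same (c (w i)))))
      where
      rearrange : ∀ a b x y → not (a xor b) xor (x xor y) ≡ not ((a xor x) xor (b xor y))
      rearrange a b x y = trans (sym (Bool.not-distribˡ-xor (a xor b) (x xor y)))
                                (cong not (xor-interchange a b x y))

    bad-uncut : ∀ {v} → v ∈ Z → ∃ λ i → w i ≡ v × i List.∈ filterᵇ (uncut g) (allFin ∣ D ∣)
    bad-uncut v∈Z with ∈Z⁻ v∈Z
    ... | exposed , c≡s , c≡s⁻¹ with proj₂ (proj₂ (proj₂ exposedList)) exposed
    ...   | i , refl = i , refl , ∈-filterᵇ⁺ (uncut g) (∈-allFin i) (uncut-true i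
      ([ (λ eq → trans c≡s (cong c (sym eq))) , (λ eq → trans c≡s⁻¹ (cong c (sym eq))) ]′
        (proj₁ (proj₂ (separatedNeighbour i)))))

    ∣Z∣≤ : ∣ Z ∣ ≤ count (uncut g) (allFin ∣ D ∣)
    ∣Z∣≤ with enumerate Z
    ... | f , inj , into , _ = injective⇒≤length {f = λ i → proj₁ (bad-uncut (into i))}
      (λ {i} {j} eq → inj (trans (sym (proj₁ (proj₂ (bad-uncut (into i)))))
        (trans (cong w eq) (proj₁ (proj₂ (bad-uncut (into j)))))))
      (λ i → proj₂ (proj₂ (bad-uncut (into i))))

  orbit∈longOddCycles : ∀ {v} → Long (canon v) → orbit (canon v) List.∈ longOddCycles H
  orbit∈longOddCycles {v} long = from (∈-longOddCycles H _) (orbit-cycle (canon-canon v) long)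

  ∣D∣≤ : ∣ D ∣ ≤ length (longOddCycles H)
  ∣D∣≤ = injective⇒≤length {f = λ i → orbit (canon (w i))}
    (λ {i} {j} eq → w-canon-injective (∈-orbit⁻ (subst (w i ∈_) eq (∈-orbit⁺ refl))))
    (λ i → orbit∈longOddCycles (proj₁ (w-exposed i)))

  -- The exposed vertices lie in different orbits of period at least 5, so the first five iterates
  -- of all of them are distinct.
  5∣D∣≤n : ∣ D ∣ * 5 ≤ n
  5∣D∣≤n = Fin.injective⇒≤ {f = λ x → at (remQuot 5 x)} λ {x} {y} eq →
    trans (sym (Fin.combine-remQuot {∣ D ∣} 5 x))
      (trans (cong (λ (i , j) → combine i j) (at-injective (remQuot 5 x) (remQuot 5 y) eq))
             (Fin.combine-remQuot {∣ D ∣} 5 y))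
    where
    at : Fin ∣ D ∣ × Fin 5 → Fin n
    at (i , j) = π^ (toℕ j) (w i)
    <period : ∀ i (j : Fin 5) → toℕ j < period (w i)
    <period i j = ℕ.≤-trans (Fin.toℕ<n j)
      (subst (5 ≤_) (period-canon (w i)) (proj₂ (proj₂ (proj₁ (w-exposed i)))))
    at-injective : ∀ x y → at x ≡ at y → x ≡ y
    at-injective (i , j) (i′ , j′) eq
      with w-canon-injective {i} {i′} (trans (sym (canon-π^ (toℕ j) (w i)))
             (trans (cong canon eq) (canon-π^ (toℕ j′) (w i′))))
    ... | refl = cong (i ,_) (Fin.toℕ-injective (π^-injective-< (<period i j) (<period i j′) eq))

  9n≤10∣∁Z∣ : 9 * n ≤ 10 * ∣ ∁ Z ∣
  9n≤10∣∁Z∣ = begin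
    9 * n                  ≡⟨ ℕ.m+n∸n≡m (9 * n) n ⟨
    9 * n + n ∸ n          ≡⟨ cong (_∸ n) (ℕ.+-comm (9 * n) n) ⟩
    10 * n ∸ n             ≤⟨ ℕ.∸-monoʳ-≤ (10 * n) 10∣Z∣≤n ⟩
    10 * n ∸ 10 * ∣ Z ∣    ≡⟨ ℕ.*-distribˡ-∸ 10 n ∣ Z ∣ ⟨
    10 * (n ∸ ∣ Z ∣)       ≡⟨ cong (10 *_) (∣∁p∣≡n∸∣p∣ Z) ⟨
    10 * ∣ ∁ Z ∣           ∎
    where
    open ℕ.≤-Reasoning
    10∣Z∣≤n : 10 * ∣ Z ∣ ≤ n
    10∣Z∣≤n = begin
      10 * ∣ Z ∣      ≡⟨ ℕ.*-assoc 5 2 ∣ Z ∣ ⟩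
      5 * (2 * ∣ Z ∣) ≤⟨ ℕ.*-monoʳ-≤ 5 2∣Z∣≤∣D∣ ⟩
      5 * ∣ D ∣       ≡⟨ ℕ.*-comm 5 ∣ D ∣ ⟩
      ∣ D ∣ * 5       ≤⟨ 5∣D∣≤n ⟩
      n               ∎

  Z⊆⋃ : Z ⊆ ⋃ (longOddCycles H)
  Z⊆⋃ v∈Z = ∈-⋃ (orbit∈longOddCycles (proj₁ (proj₁ (∈Z⁻ v∈Z)))) (∈-orbit⁺ refl)

  -- `C` is connected, hence inside one orbit, and the vertices of `Z` are unmatched, of which an
  -- orbit has at most one.
  ∣Z∩C∣≤1 : ∀ {C} → C List.∈ longOddCycles H → ∣ Z ∩ C ∣ ≤ 1
  ∣Z∩C∣≤1 {C} C∈ = ∣S∣≤ (Z ∩ C) {g = λ _ → zero} (λ _ → tt) (λ _ → refl) λ u∈ v∈ _ →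
    let u∈Z , u∈C = x∈p∩q⁻ Z C u∈ ; v∈Z , v∈C = x∈p∩q⁻ Z C v∈
        ((_ , component) , _) , _ = to (∈-longOddCycles H C) C∈
    in oneFixed (sym (walk-canon (to (component _ u∈C _) v∈C)))
         (proj₂ (proj₁ (∈Z⁻ u∈Z))) (proj₂ (proj₁ (∈Z⁻ v∈Z)))

  -- A partner of `v` under `m` would be one of the two neighbours and lie on the other side. So `v`
  -- is unmatched, and it remains to see that its orbit is long.
  monochromatic⇒∈Z : ∀ {v} → Adj H v (s v) → Adj H v (s⁻¹ v) →
    c v ≡ c (s v) → c v ≡ c (s⁻¹ v) → v ∈ Z
  monochromatic⇒∈Z {v} v~s v~s⁻¹ c≡s c≡s⁻¹ with along v
  ... | inj₂ (inj₁ mv≡) = contradiction (trans (cong c mv≡) (sym c≡s))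
        (c-m v λ fix → irrefl H (trans (sym fix) mv≡) v~s)
  ... | inj₂ (inj₂ mv≡) = contradiction (trans (cong c mv≡) (sym c≡s⁻¹))
        (c-m v λ fix → irrefl H (trans (sym fix) mv≡) v~s⁻¹)
  ... | inj₁ mv≡v = ∈Z⁺ ((long , mv≡v) , c≡s , c≡s⁻¹)
    where
    sv≢v : s v ≢ v
    sv≢v eq = irrefl H (sym eq) v~s

    ¬fixed : m (s v) ≢ s v
    ¬fixed eq = sv≢v (oneFixed (canon-π v) eq mv≡v)

    -- In a triangle the two neighbours of `v` are matched to each other, so they cannot both be on
    -- the side of `v`.
    ¬triangle : period v ≢ 3
    ¬triangle period≡3 with along (s v)
    ... | inj₁ eq        = ¬fixed eq
    ... | inj₂ (inj₂ eq) = sv≢v (trans (sym (involutive (s v)))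
      (trans (cong m (trans eq (s⁻¹-s v))) mv≡v))
    ... | inj₂ (inj₁ eq) = c-m (s v) ¬fixed (begin
      c (m (s v))  ≡⟨ cong c eq ⟩
      c (s (s v))  ≡⟨ cong c (s⁻¹-s (s (s v))) ⟨
      c (s⁻¹ (s (s (s v)))) ≡⟨ cong (c ∘ s⁻¹) (subst (λ k → π^ k v ≡ v) period≡3 (π^-period v)) ⟩
      c (s⁻¹ v)    ≡⟨ c≡s⁻¹ ⟨
      c v          ≡⟨ c≡s ⟩
      c (s v)      ∎)
      where open ≡-Reasoning

    long : Long (canon v)
    long = decidable-stable (long? (canon v)) λ ¬long →
      -- On an orbit that is not long, `m` is still `m₀`. The orbit is then odd, and since `v` is
      -- adjacent to `s v`, no edge of it is missing; so only the lengths 1 and 3 are left to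
      -- exclude.
      let odd , break = m₀-fixed (trans (sym (short ¬long)) mv≡v)
          ¬5≤ = λ 5≤ → ¬long ((λ u u~v → decidable-stable (edge? u) λ ¬e → break u~v ¬e v~s)
                 , trans (cong parity (period-canon v)) odd
                 , subst (5 ≤_) (sym (period-canon v)) 5≤)
      in [ (λ eq → sv≢v (subst (λ k → π^ k v ≡ v) eq (π^-period v))) , ¬triangle ]
           (short-odd (period v) odd ¬5≤)

  SameSideEdge : Fin n → Fin n → Set
  SameSideEdge u v = Adj H u v × c u ≡ c v × u ∉ Z × v ∉ Z

  -- Two such edges at `u` would lead to `s u` and `s⁻¹ u`, and `u` would have been deleted.
  sameSideEdges : Matching SameSideEdge
  sameSideEdges = record
    { symmetric   = λ (uv , eq , u∉ , v∉) → symm H uv , sym eq , v∉ , u∉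
    ; irreflexive = λ u≡v (uv , _) → irrefl H u≡v uv
    ; unique      = unique
    ; partner?    = λ u → Fin.any? λ v →
        adj? H u v ×-dec (c u Bool.≟ c v) ×-dec ¬? (u ∈? Z) ×-dec ¬? (v ∈? Z)
    }
    where
    unique : ∀ {u v w} → SameSideEdge u v → SameSideEdge u w → v ≡ w
    unique (uv , cuv , u∉ , _) (uw , cuw , _) with covers uv | covers uw
    ... | inj₁ eq   | inj₁ eq′  = trans eq (sym eq′)
    ... | inj₂ eq   | inj₂ eq′  = trans eq (sym eq′)
    ... | inj₁ refl | inj₂ refl = contradiction (monochromatic⇒∈Z uv uw cuv cuw) u∉
    ... | inj₂ refl | inj₁ refl = contradiction (monochromatic⇒∈Z uw uv cuw cuv) u∉

  colouring : Colourable 4 (glueCliques H Y -ᵍ Z)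
  colouring = (λ (v , _) → colour v) , λ {u} {v} → proper (proj₂ u) (proj₂ v)
    where
    -- Adjacent vertices that agree in the first bit `c` are matched in one of these two matchings,
    -- so the second bit `d` tells them apart.
    d,proper = matchingsColouring id id sameSideEdges (sameSide c c-paired)

    d : Fin n → Bool
    d = proj₁ d,proper

    colour : Fin n → Fin 4
    colour v = combine (bit (c v)) (bit (d v))

    proper : ∀ {u v} → u ∉ Z → v ∉ Z → Adj (glueCliques H Y) u v → colour u ≢ colour v
    proper {u} {v} u∉ v∉ adj eq =
      let eqc , eqd = Fin.combine-injective (bit (c u)) (bit (d u)) (bit (c v)) (bit (d v)) eq
      in [ (λ uv → proj₁ (proj₂ d,proper) (uv , bit-injective eqc , u∉ , v∉) (bit-injective eqd))
         , (λ uv → proj₂ (proj₂ d,proper) (uv , bit-injective eqc) (bit-injective eqd)) ]′ adj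

theorem2p1 : ∀ (n : ℕ) (H : Graph (Fin n)) → Δ H ≤ 2 →
    ∀ (q : ℕ) (Y : Fin q → Subset n) → (∀ j → ∣ Y j ∣ ≡ 4) → PairwiseDisjoint Y →
    ∃ λ (Z : Subset n) →
    Z ⊆ ⋃ (longOddCycles H)
    × 2 * ∣ Z ∣ ≤ length (longOddCycles H)
    × Colourable 4 (glueCliques H Y -ᵍ Z)
    × All (λ C → ∣ Z ∩ C ∣ ≤ 1) (longOddCycles H)
    × 9 * n ≤ 10 * ∣ ∁ Z ∣
theorem2p1 n H Δ≤2 q Y ∣Y∣≡4 disjoint =
  Z , Z⊆⋃ , ℕ.≤-trans 2∣Z∣≤∣D∣ ∣D∣≤ , colouring , All.tabulate ∣Z∩C∣≤1 , 9n≤10∣∁Z∣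
  where open Deletion H Δ≤2 Y ∣Y∣≡4 disjoint
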